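{- For any regular po-category $\mathscr R=\mathbb R\mathrm{el}_{\mathcal R}$ (the relations po-category of a regular category $\mathcal R$), the po-functor $\mathrm{Sub}_{\mathcal R}=\mathscr R(I,-)\colon\mathscr R\to\mathbb P\mathrm{oset}$ is ajax.
   Context: A po-category is a category enriched in posets; a po-functor is a poset-enriched functor. A symmetric monoidal po-category is a po-category with po-functors $\otimes$ and $I$ whose underlying 1-structure is a symmetric monoidal category. $\mathbb P\mathrm{oset}$ is the po-category of posets and monotone maps (ordered pointwise), with cartesian product as monoidal structure. A regular category has finite limits, coequalizers of kernel pairs, and pullback-stable regular epimorphisms; then every map factors as a regular epi followed by a mono (its image). For a regular category $\mathcal R$, its relations po-category $\mathbb R\mathrm{el}_{\mathcal R}$ has the same objects as $\mathcal R$; morphisms $r\to s$ are subobjects (isomorphism classes of monos) $x\subseteq r\times s$, ordered by inclusion; the composite of $x\subseteq r\times s$ and $y\subseteq s\times t$ is the image of $x\times_s y\to r\times t$; monoidal unit $I=1$ (terminal object) and $r_1\otimes r_2=r_1\times r_2$. A regular po-category is a po-category isomorphic to some $\mathbb R\mathrm{el}_{\mathcal R}$. The po-functor $\mathrm{Sub}_{\mathcal R}=\mathscr R(I,-)$ sends $r$ to the poset $\mathrm{Sub}(r)=\mathscr R(I,r)$ of subobjects of $r$ and acts on relations by composition. It has its canonical lax monoidal structure: $1\to\mathscr R(I,I)$ picks out $\mathrm{id}_I$, and $\mathscr R(I,r_1)\times\mathscr R(I,r_2)\to\mathscr R(I,r_1\otimes r_2)$ is $(\varphi_1,\varphi_2)\mapsto\varphi_1\otimes\varphi_2$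 (using $I\otimes I\cong I$). A po-functor $F\colon\mathscr C\to\mathscr D$ between symmetric monoidal po-categories is ajax (adjoint-lax) if it is lax symmetric monoidal and its laxators $\rho\colon I\to F(I)$ and $\rho_{c,c'}\colon F(c)\otimes F(c')\to F(c\otimes c')$ are right adjoints in $\mathscr D$ (a morphism $g\colon a\to b$ in a po-category is a right adjoint if there is $\lambda\colon b\to a$ such that, writing composition in diagrammatic order, $\mathrm{id}_b\le\lambda\,;g$ and $g\,;\lambda\le\mathrm{id}_a$). -}

module Defs where

open import Level using (Level; _⊔_; suc)
open import Data.Product using (Σ; ∃-syntax; _×_; _,_; proj₁; proj₂)
open import Data.Product.Relation.Binary.Pointwise.NonDependent using (×-poset)
open import Data.Unit.Polymorphic using (⊤; tt)
open import Relation.Binary.Bundles using (Poset; Setoid)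
open import Relation.Binary.Structures using (IsEquivalence)
open import Relation.Binary.Morphism.Bundles using (PosetHomomorphism; mkPosetHomo)
import Relation.Binary.Morphism.Construct.Composition as Composition
import Relation.Binary.Morphism.Construct.Identity as Identity
import Relation.Binary.Reasoning.Setoid as SetoidReasoning

------------------------------------------------------------------------
-- Po-categories

-- Composition in po-categories is written in diagrammatic order.
record PoCategory (o c ℓ₁ ℓ₂ : Level) : Set (suc (o ⊔ c ⊔ ℓ₁ ⊔ ℓ₂)) where
  infix  4 _⇒_
  infixl 7 _⨟_
  field
    Obj : Set o
    Hom : Obj → Obj → Poset c ℓ₁ ℓ₂

  _⇒_ : Obj → Obj → Set c
  a ⇒ b = Poset.Carrier (Hom a b)

  open module HomPoset {a b : Obj} = Poset (Hom a b) public
    using (_≈_; _≤_)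

  field
    id        : ∀ {a} → a ⇒ a
    _⨟_       : ∀ {a b c} → a ⇒ b → b ⇒ c → a ⇒ c
    ⨟-mono    : ∀ {a b c} {f f′ : a ⇒ b} {g g′ : b ⇒ c} →
                f ≤ f′ → g ≤ g′ → (f ⨟ g) ≤ (f′ ⨟ g′)
    assoc     : ∀ {a b c d} {f : a ⇒ b} {g : b ⇒ c} {h : c ⇒ d} →
                ((f ⨟ g) ⨟ h) ≈ (f ⨟ (g ⨟ h))
    identityˡ : ∀ {a b} {f : a ⇒ b} → (id ⨟ f) ≈ f
    identityʳ : ∀ {a b} {f : a ⇒ b} → (f ⨟ id) ≈ f

  record _≅_ (a b : Obj) : Set (c ⊔ ℓ₁) where
    field
      from : a ⇒ b
      to   : b ⇒ a
      isoˡ : (from ⨟ to) ≈ id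
      isoʳ : (to ⨟ from) ≈ id

  IsRightAdjoint : ∀ {a b} → a ⇒ b → Set (c ⊔ ℓ₂)
  IsRightAdjoint {a} {b} g = ∃[ l ] (id {b} ≤ (l ⨟ g)) × ((g ⨟ l) ≤ id {a})

record PoFunctor {o c ℓ₁ ℓ₂ o′ c′ ℓ₁′ ℓ₂′}
                 (C : PoCategory o c ℓ₁ ℓ₂) (D : PoCategory o′ c′ ℓ₁′ ℓ₂′)
                 : Set (o ⊔ c ⊔ ℓ₁ ⊔ ℓ₂ ⊔ o′ ⊔ c′ ⊔ ℓ₁′ ⊔ ℓ₂′) where
  private
    module C = PoCategory C
    module D = PoCategory D
  field
    F₀           : C.Obj → D.Obj
    F₁           : ∀ {a b} → a C.⇒ b → F₀ a D.⇒ F₀ b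
    mono         : ∀ {a b} {f g : a C.⇒ b} → f C.≤ g → F₁ f D.≤ F₁ g
    identity     : ∀ {a} → F₁ (C.id {a}) D.≈ D.id
    homomorphism : ∀ {a b c} {f : a C.⇒ b} {g : b C.⇒ c} →
                   F₁ (f C.⨟ g) D.≈ (F₁ f D.⨟ F₁ g)

_×ᶜ_ : ∀ {o c ℓ₁ ℓ₂ o′ c′ ℓ₁′ ℓ₂′} →
       PoCategory o c ℓ₁ ℓ₂ → PoCategory o′ c′ ℓ₁′ ℓ₂′ →
       PoCategory (o ⊔ o′) (c ⊔ c′) (ℓ₁ ⊔ ℓ₁′) (ℓ₂ ⊔ ℓ₂′)
C ×ᶜ D = record
  { Obj       = C.Obj × D.Obj
  ; Hom       = λ a b → ×-poset (C.Hom (proj₁ a) (proj₁ b)) (D.Hom (proj₂ a) (proj₂ b))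
  ; id        = C.id , D.id
  ; _⨟_       = λ f g → (proj₁ f C.⨟ proj₁ g) , (proj₂ f D.⨟ proj₂ g)
  ; ⨟-mono    = λ p q → C.⨟-mono (proj₁ p) (proj₁ q) , D.⨟-mono (proj₂ p) (proj₂ q)
  ; assoc     = C.assoc , D.assoc
  ; identityˡ = C.identityˡ , D.identityˡ
  ; identityʳ = C.identityʳ , D.identityʳ
  }
  where
  module C = PoCategory C
  module D = PoCategory D

record SymmetricMonoidalPoCategory (o c ℓ₁ ℓ₂ : Level)
                                   : Set (suc (o ⊔ c ⊔ ℓ₁ ⊔ ℓ₂)) where
  infixr 8 _⊗₀_ _⊗₁_
  field
    poCategory : PoCategory o c ℓ₁ ℓ₂

  open PoCategory poCategory public

  field
    unit : Obj
    ⊗    : PoFunctor (poCategory ×ᶜ poCategory) poCategory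

  _⊗₀_ : Obj → Obj → Obj
  a ⊗₀ b = PoFunctor.F₀ ⊗ (a , b)

  _⊗₁_ : ∀ {a b a′ b′} → a ⇒ b → a′ ⇒ b′ → a ⊗₀ a′ ⇒ b ⊗₀ b′
  f ⊗₁ g = PoFunctor.F₁ ⊗ (f , g)

  field
    associator : ∀ a b c → ((a ⊗₀ b) ⊗₀ c) ≅ (a ⊗₀ (b ⊗₀ c))
    unitorˡ    : ∀ a → (unit ⊗₀ a) ≅ a
    unitorʳ    : ∀ a → (a ⊗₀ unit) ≅ a
    σ          : ∀ a b → a ⊗₀ b ⇒ b ⊗₀ a

  α : ∀ a b c → (a ⊗₀ b) ⊗₀ c ⇒ a ⊗₀ (b ⊗₀ c)
  α a b c = _≅_.from (associator a b c)

  λ⇒ : ∀ a → unit ⊗₀ a ⇒ a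
  λ⇒ a = _≅_.from (unitorˡ a)

  λ⇐ : ∀ a → a ⇒ unit ⊗₀ a
  λ⇐ a = _≅_.to (unitorˡ a)

  ρ⇒ : ∀ a → a ⊗₀ unit ⇒ a
  ρ⇒ a = _≅_.from (unitorʳ a)

  field
    α-natural : ∀ {a b c a′ b′ c′} (f : a ⇒ a′) (g : b ⇒ b′) (h : c ⇒ c′) →
                (((f ⊗₁ g) ⊗₁ h) ⨟ α a′ b′ c′) ≈ (α a b c ⨟ (f ⊗₁ (g ⊗₁ h)))
    λ-natural : ∀ {a b} (f : a ⇒ b) → ((id ⊗₁ f) ⨟ λ⇒ b) ≈ (λ⇒ a ⨟ f)
    ρ-natural : ∀ {a b} (f : a ⇒ b) → ((f ⊗₁ id) ⨟ ρ⇒ b) ≈ (ρ⇒ a ⨟ f)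
    σ-natural : ∀ {a b a′ b′} (f : a ⇒ a′) (g : b ⇒ b′) →
                ((f ⊗₁ g) ⨟ σ a′ b′) ≈ (σ a b ⨟ (g ⊗₁ f))
    triangle  : ∀ a b → (α a unit b ⨟ (id ⊗₁ λ⇒ b)) ≈ (ρ⇒ a ⊗₁ id)
    pentagon  : ∀ a b c d →
                (α (a ⊗₀ b) c d ⨟ α a b (c ⊗₀ d)) ≈
                (((α a b c ⊗₁ id) ⨟ α a (b ⊗₀ c) d) ⨟ (id ⊗₁ α b c d))
    hexagon   : ∀ a b c →
                ((α a b c ⨟ σ a (b ⊗₀ c)) ⨟ α b c a) ≈
                (((σ a b ⊗₁ id) ⨟ α b a c) ⨟ (id ⊗₁ σ a c))
    symmetry  : ∀ a b → (σ a b ⨟ σ b a) ≈ id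

------------------------------------------------------------------------
-- Ajax po-functors

module _ {o c ℓ₁ ℓ₂ o′ c′ ℓ₁′ ℓ₂′}
         {C : SymmetricMonoidalPoCategory o c ℓ₁ ℓ₂}
         {D : SymmetricMonoidalPoCategory o′ c′ ℓ₁′ ℓ₂′} where
  private
    module C = SymmetricMonoidalPoCategory C
    module D = SymmetricMonoidalPoCategory D

  module _ (F  : PoFunctor C.poCategory D.poCategory)
           (ρ  : D.unit D.⇒ PoFunctor.F₀ F C.unit)
           (ρ₂ : ∀ a b → PoFunctor.F₀ F a D.⊗₀ PoFunctor.F₀ F b D.⇒
                         PoFunctor.F₀ F (a C.⊗₀ b)) where
    open PoFunctor F using (F₀; F₁)

    record IsLaxSymmetricMonoidal : Set (o ⊔ c ⊔ ℓ₁′) where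
      field
        natural       : ∀ {a b a′ b′} (f : a C.⇒ a′) (g : b C.⇒ b′) →
                        ((F₁ f D.⊗₁ F₁ g) D.⨟ ρ₂ a′ b′) D.≈ (ρ₂ a b D.⨟ F₁ (f C.⊗₁ g))
        associativity : ∀ a b c →
                        (((ρ₂ a b D.⊗₁ D.id) D.⨟ ρ₂ (a C.⊗₀ b) c) D.⨟ F₁ (C.α a b c)) D.≈
                        ((D.α (F₀ a) (F₀ b) (F₀ c) D.⨟ (D.id D.⊗₁ ρ₂ b c)) D.⨟ ρ₂ a (b C.⊗₀ c))
        unitalityˡ    : ∀ a →
                        (((ρ D.⊗₁ D.id) D.⨟ ρ₂ C.unit a) D.⨟ F₁ (C.λ⇒ a)) D.≈ D.λ⇒ (F₀ a)
        unitalityʳ    : ∀ a →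
                        (((D.id D.⊗₁ ρ) D.⨟ ρ₂ a C.unit) D.⨟ F₁ (C.ρ⇒ a)) D.≈ D.ρ⇒ (F₀ a)
        symmetric     : ∀ a b →
                        (ρ₂ a b D.⨟ F₁ (C.σ a b)) D.≈ (D.σ (F₀ a) (F₀ b) D.⨟ ρ₂ b a)

    record IsAjax : Set (o ⊔ c ⊔ c′ ⊔ ℓ₁′ ⊔ ℓ₂′) where
      field
        isLaxSymmetricMonoidal : IsLaxSymmetricMonoidal
        ρ-isRightAdjoint       : D.IsRightAdjoint ρ
        ρ₂-isRightAdjoint      : ∀ a b → D.IsRightAdjoint (ρ₂ a b)

------------------------------------------------------------------------
-- The po-category of posets

open PosetHomomorphism using (⟦_⟧) renaming (mono to ⟦⟧-mono)

module _ {c ℓ₁ ℓ₂ : Level} where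

  pointwise : Poset c ℓ₁ ℓ₂ → Poset c ℓ₁ ℓ₂ → Poset (c ⊔ ℓ₁ ⊔ ℓ₂) (c ⊔ ℓ₁) (c ⊔ ℓ₂)
  pointwise P Q = record
    { Carrier        = PosetHomomorphism P Q
    ; _≈_            = λ f g → ∀ x → ⟦ f ⟧ x Q.≈ ⟦ g ⟧ x
    ; _≤_            = λ f g → ∀ x → ⟦ f ⟧ x Q.≤ ⟦ g ⟧ x
    ; isPartialOrder = record
      { isPreorder = record
        { isEquivalence = record
          { refl  = λ _ → Q.Eq.refl
          ; sym   = λ p x → Q.Eq.sym (p x)
          ; trans = λ p q x → Q.Eq.trans (p x) (q x)
          }
        ; reflexive = λ p x → Q.reflexive (p x)
        ; trans     = λ p q x → Q.trans (p x) (q x)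
        }
      ; antisym = λ p q x → Q.antisym (p x) (q x)
      }
    }
    where module Q = Poset Q

  ⊤-poset : Poset c ℓ₁ ℓ₂
  ⊤-poset = record
    { Carrier        = ⊤
    ; _≈_            = λ _ _ → ⊤
    ; _≤_            = λ _ _ → ⊤
    ; isPartialOrder = _
    }

POSET : ∀ c ℓ₁ ℓ₂ → PoCategory (suc (c ⊔ ℓ₁ ⊔ ℓ₂)) (c ⊔ ℓ₁ ⊔ ℓ₂) (c ⊔ ℓ₁) (c ⊔ ℓ₂)
POSET c ℓ₁ ℓ₂ = record
  { Obj       = Poset c ℓ₁ ℓ₂
  ; Hom       = pointwise
  ; id        = λ {P} → Identity.posetHomomorphism P
  ; _⨟_       = Composition.posetHomomorphism
  ; ⨟-mono    = λ {_} {_} {R} {_} {f′} {g} p q x →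
                Poset.trans R (⟦⟧-mono g (p x)) (q (⟦ f′ ⟧ x))
  ; assoc     = λ {_} {_} {_} {Q} _ → Poset.Eq.refl Q
  ; identityˡ = λ {_} {Q} _ → Poset.Eq.refl Q
  ; identityʳ = λ {_} {Q} _ → Poset.Eq.refl Q
  }

ℙoset : ∀ c ℓ₁ ℓ₂ →
        SymmetricMonoidalPoCategory (suc (c ⊔ ℓ₁ ⊔ ℓ₂)) (c ⊔ ℓ₁ ⊔ ℓ₂) (c ⊔ ℓ₁) (c ⊔ ℓ₂)
ℙoset c ℓ₁ ℓ₂ = record
  { poCategory = POSET c ℓ₁ ℓ₂
  ; unit       = 𝟙
  ; ⊗          = record
    { F₀           = λ (P , Q) → ×-poset P Q
    ; F₁           = λ {(P , Q)} {(P′ , Q′)} (f , g) →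
                     mkPosetHomo (×-poset P Q) (×-poset P′ Q′)
                       (λ (x , y) → ⟦ f ⟧ x , ⟦ g ⟧ y)
                       (λ (p , q) → ⟦⟧-mono f p , ⟦⟧-mono g q)
    ; mono         = λ (p , q) (x , y) → p x , q y
    ; identity     = λ {(P , Q)} _ → Poset.Eq.refl (×-poset P Q)
    ; homomorphism = λ {_} {_} {(P , Q)} _ → Poset.Eq.refl (×-poset P Q)
    }
  ; associator = λ P Q R → record
    { from = mkPosetHomo (×-poset (×-poset P Q) R) (×-poset P (×-poset Q R))
               (λ ((x , y) , z) → x , (y , z)) (λ ((p , q) , r) → p , (q , r))
    ; to   = mkPosetHomo (×-poset P (×-poset Q R)) (×-poset (×-poset P Q) R)
               (λ (x , (y , z)) → (x , y) , z) (λ (p , (q , r)) → (p , q) , r)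
    ; isoˡ = λ _ → Poset.Eq.refl (×-poset (×-poset P Q) R)
    ; isoʳ = λ _ → Poset.Eq.refl (×-poset P (×-poset Q R))
    }
  ; unitorˡ    = λ P → record
    { from = mkPosetHomo (×-poset 𝟙 P) P proj₂ proj₂
    ; to   = mkPosetHomo P (×-poset 𝟙 P) (tt ,_) (tt ,_)
    ; isoˡ = λ _ → Poset.Eq.refl (×-poset 𝟙 P)
    ; isoʳ = λ _ → Poset.Eq.refl P
    }
  ; unitorʳ    = λ P → record
    { from = mkPosetHomo (×-poset P 𝟙) P proj₁ proj₁
    ; to   = mkPosetHomo P (×-poset P 𝟙) (_, tt) (_, tt)
    ; isoˡ = λ _ → Poset.Eq.refl (×-poset P 𝟙)
    ; isoʳ = λ _ → Poset.Eq.refl P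
    }
  ; σ          = λ P Q → mkPosetHomo (×-poset P Q) (×-poset Q P)
                   (λ (x , y) → y , x) (λ (p , q) → q , p)
  ; α-natural  = λ {_} {_} {_} {P} {Q} {R} _ _ _ _ → Poset.Eq.refl (×-poset P (×-poset Q R))
  ; λ-natural  = λ {_} {Q} _ _ → Poset.Eq.refl Q
  ; ρ-natural  = λ {_} {Q} _ _ → Poset.Eq.refl Q
  ; σ-natural  = λ {_} {_} {P} {Q} _ _ _ → Poset.Eq.refl (×-poset Q P)
  ; triangle   = λ P Q _ → Poset.Eq.refl (×-poset P Q)
  ; pentagon   = λ P Q R S _ → Poset.Eq.refl (×-poset P (×-poset Q (×-poset R S)))
  ; hexagon    = λ P Q R _ → Poset.Eq.refl (×-poset Q (×-poset R P))
  ; symmetry   = λ P Q _ → Poset.Eq.refl (×-poset P Q)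
  }
  where
  𝟙 : Poset c ℓ₁ ℓ₂
  𝟙 = ⊤-poset

------------------------------------------------------------------------
-- Representable po-functors and their canonical laxators

module _ {o c ℓ₁ ℓ₂} (C : PoCategory o c ℓ₁ ℓ₂) where
  open PoCategory C

  Hom[_,-] : Obj → PoFunctor C (POSET c ℓ₁ ℓ₂)
  Hom[ a ,-] = record
    { F₀           = Hom a
    ; F₁           = λ {b} {d} f → mkPosetHomo (Hom a b) (Hom a d) (_⨟ f)
                       (λ p → ⨟-mono p HomPoset.refl)
    ; mono         = λ p _ → ⨟-mono HomPoset.refl p
    ; identity     = λ _ → identityʳ
    ; homomorphism = λ _ → HomPoset.Eq.sym assoc
    }

module _ {o c ℓ₁ ℓ₂} (C : SymmetricMonoidalPoCategory o c ℓ₁ ℓ₂) where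
  open SymmetricMonoidalPoCategory C
  private
    module P = PoCategory (POSET c ℓ₁ ℓ₂)

  Hom[unit,-] : PoFunctor poCategory (POSET c ℓ₁ ℓ₂)
  Hom[unit,-] = Hom[ poCategory ,-] unit

  Hom-ρ : ⊤-poset P.⇒ Hom unit unit
  Hom-ρ = mkPosetHomo ⊤-poset (Hom unit unit) (λ _ → id) (λ _ → HomPoset.refl)

  Hom-ρ₂ : ∀ a b → ×-poset (Hom unit a) (Hom unit b) P.⇒ Hom unit (a ⊗₀ b)
  Hom-ρ₂ a b = mkPosetHomo (×-poset (Hom unit a) (Hom unit b)) (Hom unit (a ⊗₀ b))
    (λ (φ , ψ) → λ⇐ unit ⨟ (φ ⊗₁ ψ))
    (λ p → ⨟-mono HomPoset.refl (PoFunctor.mono ⊗ p))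

------------------------------------------------------------------------
-- Regular categories

record Category (o ℓ e : Level) : Set (suc (o ⊔ ℓ ⊔ e)) where
  infix  4 _⇒_ _≈_
  infixr 9 _∘_
  field
    Obj       : Set o
    _⇒_       : Obj → Obj → Set ℓ
    _≈_       : ∀ {A B} → A ⇒ B → A ⇒ B → Set e
    id        : ∀ {A} → A ⇒ A
    _∘_       : ∀ {A B C} → B ⇒ C → A ⇒ B → A ⇒ C
    assoc     : ∀ {A B C D} {f : A ⇒ B} {g : B ⇒ C} {h : C ⇒ D} →
                (h ∘ g) ∘ f ≈ h ∘ (g ∘ f)
    identityˡ : ∀ {A B} {f : A ⇒ B} → id ∘ f ≈ f
    identityʳ : ∀ {A B} {f : A ⇒ B} → f ∘ id ≈ f
    equiv     : ∀ {A B} → IsEquivalence (_≈_ {A} {B})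
    ∘-resp-≈  : ∀ {A B C} {f h : B ⇒ C} {g i : A ⇒ B} →
                f ≈ h → g ≈ i → f ∘ g ≈ h ∘ i

  hom-setoid : Obj → Obj → Setoid ℓ e
  hom-setoid A B = record { Carrier = A ⇒ B ; _≈_ = _≈_ ; isEquivalence = equiv }

  IsMono : ∀ {A B} → A ⇒ B → Set (o ⊔ ℓ ⊔ e)
  IsMono {A} m = ∀ {X} (f g : X ⇒ A) → m ∘ f ≈ m ∘ g → f ≈ g

  record Terminal : Set (o ⊔ ℓ ⊔ e) where
    field
      𝟙        : Obj
      !        : ∀ {A} → A ⇒ 𝟙
      !-unique : ∀ {A} (f : A ⇒ 𝟙) → ! ≈ f

  record Product (A B : Obj) : Set (o ⊔ ℓ ⊔ e) where
    field
      A×B      : Obj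
      π₁       : A×B ⇒ A
      π₂       : A×B ⇒ B
      ⟨_,_⟩    : ∀ {X} → X ⇒ A → X ⇒ B → X ⇒ A×B
      project₁ : ∀ {X} {f : X ⇒ A} {g : X ⇒ B} → π₁ ∘ ⟨ f , g ⟩ ≈ f
      project₂ : ∀ {X} {f : X ⇒ A} {g : X ⇒ B} → π₂ ∘ ⟨ f , g ⟩ ≈ g
      unique   : ∀ {X} {h : X ⇒ A×B} {f : X ⇒ A} {g : X ⇒ B} →
                 π₁ ∘ h ≈ f → π₂ ∘ h ≈ g → ⟨ f , g ⟩ ≈ h

  record Equalizer {A B} (f g : A ⇒ B) : Set (o ⊔ ℓ ⊔ e) where
    field
      obj       : Obj
      arr       : obj ⇒ A
      equality  : f ∘ arr ≈ g ∘ arr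
      equalize  : ∀ {X} {h : X ⇒ A} → f ∘ h ≈ g ∘ h → X ⇒ obj
      universal : ∀ {X} {h : X ⇒ A} {eq : f ∘ h ≈ g ∘ h} → arr ∘ equalize eq ≈ h
      unique    : ∀ {X} {h : X ⇒ A} {i : X ⇒ obj} {eq : f ∘ h ≈ g ∘ h} →
                  arr ∘ i ≈ h → i ≈ equalize eq

  record IsCoequalizer {A B Q} (f g : A ⇒ B) (q : B ⇒ Q) : Set (o ⊔ ℓ ⊔ e) where
    field
      equality   : q ∘ f ≈ q ∘ g
      coequalize : ∀ {X} {h : B ⇒ X} → h ∘ f ≈ h ∘ g → Q ⇒ X
      universal  : ∀ {X} {h : B ⇒ X} {eq : h ∘ f ≈ h ∘ g} → coequalize eq ∘ q ≈ h
      unique     : ∀ {X} {h : B ⇒ X} {i : Q ⇒ X} {eq : h ∘ f ≈ h ∘ g} →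
                   i ∘ q ≈ h → i ≈ coequalize eq

  record Coequalizer {A B} (f g : A ⇒ B) : Set (o ⊔ ℓ ⊔ e) where
    field
      obj           : Obj
      arr           : B ⇒ obj
      isCoequalizer : IsCoequalizer f g arr

  record IsPullback {P A B C} (p₁ : P ⇒ A) (p₂ : P ⇒ B) (f : A ⇒ C) (g : B ⇒ C)
                    : Set (o ⊔ ℓ ⊔ e) where
    field
      commute    : f ∘ p₁ ≈ g ∘ p₂
      universal  : ∀ {X} {h₁ : X ⇒ A} {h₂ : X ⇒ B} → f ∘ h₁ ≈ g ∘ h₂ → X ⇒ P
      p₁∘univ≈h₁ : ∀ {X} {h₁ : X ⇒ A} {h₂ : X ⇒ B} {eq : f ∘ h₁ ≈ g ∘ h₂} →
                   p₁ ∘ universal eq ≈ h₁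
      p₂∘univ≈h₂ : ∀ {X} {h₁ : X ⇒ A} {h₂ : X ⇒ B} {eq : f ∘ h₁ ≈ g ∘ h₂} →
                   p₂ ∘ universal eq ≈ h₂
      unique     : ∀ {X} {h₁ : X ⇒ A} {h₂ : X ⇒ B} {i : X ⇒ P} {eq : f ∘ h₁ ≈ g ∘ h₂} →
                   p₁ ∘ i ≈ h₁ → p₂ ∘ i ≈ h₂ → i ≈ universal eq

  IsKernelPair : ∀ {K A B} → A ⇒ B → (p q : K ⇒ A) → Set (o ⊔ ℓ ⊔ e)
  IsKernelPair f p q = IsPullback p q f f

  IsRegularEpi : ∀ {B Q} → B ⇒ Q → Set (o ⊔ ℓ ⊔ e)
  IsRegularEpi {B} q = ∃[ A ] ∃[ f ] ∃[ g ] IsCoequalizer {A} {B} f g q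

record RegularCategory (o ℓ e : Level) : Set (suc (o ⊔ ℓ ⊔ e)) where
  field
    category : Category o ℓ e

  open Category category public

  -- Terminal object, binary products and equalizers supply all finite limits.
  field
    terminal               : Terminal
    product                : ∀ A B → Product A B
    equalizer              : ∀ {A B} (f g : A ⇒ B) → Equalizer f g
    kernelPair-coequalizer : ∀ {K A B} {f : A ⇒ B} {p q : K ⇒ A} →
                             IsKernelPair f p q → Coequalizer p q
    regularEpi-stable      : ∀ {P A B C} {p₁ : P ⇒ A} {p₂ : P ⇒ B} {f : A ⇒ C} {g : B ⇒ C} →
                             IsPullback p₁ p₂ f g → IsRegularEpi f → IsRegularEpi p₂

------------------------------------------------------------------------
-- Finite limits and images in a regular category

module RegularCategoryProperties {o ℓ e} (R : RegularCategory o ℓ e) where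
  open RegularCategory R
  open Terminal terminal public

  module Equiv {A B : Obj} = IsEquivalence (equiv {A} {B})
  open Equiv public using () renaming (refl to ≈-refl; sym to ≈-sym; trans to ≈-trans)
  open module HomReasoning {A B : Obj} = SetoidReasoning (hom-setoid A B) public

  ∘-congˡ : ∀ {A B C} {f : B ⇒ C} {g h : A ⇒ B} → g ≈ h → f ∘ g ≈ f ∘ h
  ∘-congˡ = ∘-resp-≈ ≈-refl

  ∘-congʳ : ∀ {A B C} {f h : B ⇒ C} {g : A ⇒ B} → f ≈ h → f ∘ g ≈ h ∘ g
  ∘-congʳ p = ∘-resp-≈ p ≈-refl

  pullˡ : ∀ {A B C D} {f : C ⇒ D} {g : B ⇒ C} {h : B ⇒ D} {k : A ⇒ B} →
          f ∘ g ≈ h → f ∘ (g ∘ k) ≈ h ∘ k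
  pullˡ p = ≈-trans (≈-sym assoc) (∘-congʳ p)

  pullʳ : ∀ {A B C D} {f : C ⇒ D} {g : B ⇒ C} {k : A ⇒ B} {h : A ⇒ C} →
          g ∘ k ≈ h → (f ∘ g) ∘ k ≈ f ∘ h
  pullʳ p = ≈-trans assoc (∘-congˡ p)

  infixr 8 _×ₒ_
  _×ₒ_ : Obj → Obj → Obj
  A ×ₒ B = Product.A×B (product A B)

  open module Products {A B : Obj} = Product (product A B) public
    using (π₁; π₂; ⟨_,_⟩; project₁; project₂; unique)

  ⟨⟩-cong : ∀ {A B X} {f f′ : X ⇒ A} {g g′ : X ⇒ B} →
            f ≈ f′ → g ≈ g′ → ⟨ f , g ⟩ ≈ ⟨ f′ , g′ ⟩
  ⟨⟩-cong p q = unique (≈-trans project₁ (≈-sym p)) (≈-trans project₂ (≈-sym q))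

  ×-η : ∀ {A B X} {h : X ⇒ A ×ₒ B} → ⟨ π₁ ∘ h , π₂ ∘ h ⟩ ≈ h
  ×-η = unique ≈-refl ≈-refl

  ×-ext : ∀ {A B X} {h k : X ⇒ A ×ₒ B} → π₁ ∘ h ≈ π₁ ∘ k → π₂ ∘ h ≈ π₂ ∘ k → h ≈ k
  ×-ext p q = ≈-trans (≈-sym (unique p q)) ×-η

  ⟨⟩-inj₁ : ∀ {A B X} {f f′ : X ⇒ A} {g g′ : X ⇒ B} → ⟨ f , g ⟩ ≈ ⟨ f′ , g′ ⟩ → f ≈ f′
  ⟨⟩-inj₁ p = ≈-trans (≈-sym project₁) (≈-trans (∘-congˡ p) project₁)

  ⟨⟩-inj₂ : ∀ {A B X} {f f′ : X ⇒ A} {g g′ : X ⇒ B} → ⟨ f , g ⟩ ≈ ⟨ f′ , g′ ⟩ → g ≈ g′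
  ⟨⟩-inj₂ p = ≈-trans (≈-sym project₂) (≈-trans (∘-congˡ p) project₂)

  ⟨⟩∘ : ∀ {A B X Y} {f : X ⇒ A} {g : X ⇒ B} {h : Y ⇒ X} →
        ⟨ f , g ⟩ ∘ h ≈ ⟨ f ∘ h , g ∘ h ⟩
  ⟨⟩∘ = ≈-sym (unique (pullˡ project₁) (pullˡ project₂))

  !-unique₂ : ∀ {A} {f g : A ⇒ 𝟙} → f ≈ g
  !-unique₂ {_} {f} {g} = ≈-trans (≈-sym (!-unique f)) (!-unique g)

  record Pullback {A B C} (f : A ⇒ C) (g : B ⇒ C) : Set (o ⊔ ℓ ⊔ e) where
    field
      P          : Obj
      p₁         : P ⇒ A
      p₂         : P ⇒ B
      isPullback : IsPullback p₁ p₂ f g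
    open IsPullback isPullback public

  pullback : ∀ {A B C} (f : A ⇒ C) (g : B ⇒ C) → Pullback f g
  pullback f g = record
    { P          = E.obj
    ; p₁         = π₁ ∘ E.arr
    ; p₂         = π₂ ∘ E.arr
    ; isPullback = record
      { commute    = ≈-trans (≈-sym assoc) (≈-trans E.equality assoc)
      ; universal  = λ eq → E.equalize (lift eq)
      ; p₁∘univ≈h₁ = ≈-trans (pullʳ E.universal) project₁
      ; p₂∘univ≈h₂ = ≈-trans (pullʳ E.universal) project₂
      ; unique     = λ p q → E.unique
          (≈-sym (unique (≈-trans (≈-sym assoc) p) (≈-trans (≈-sym assoc) q)))
      }
    }
    where
    module E = Equalizer (equalizer (f ∘ π₁) (g ∘ π₂))
    lift : ∀ {X} {h₁ : X ⇒ _} {h₂ : X ⇒ _} → f ∘ h₁ ≈ g ∘ h₂ →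
           (f ∘ π₁) ∘ ⟨ h₁ , h₂ ⟩ ≈ (g ∘ π₂) ∘ ⟨ h₁ , h₂ ⟩
    lift eq = ≈-trans (pullʳ project₁) (≈-trans eq (≈-sym (pullʳ project₂)))

  regularEpi⇒epi : ∀ {A B X} {q : A ⇒ B} → IsRegularEpi q →
                   {f g : B ⇒ X} → f ∘ q ≈ g ∘ q → f ≈ g
  regularEpi⇒epi {q = q} (_ , _ , _ , c) {f} {g} p =
    ≈-trans (C.unique {eq = eq} p) (≈-sym (C.unique ≈-refl))
    where
    module C = IsCoequalizer c
    eq = ≈-trans assoc (≈-trans (∘-congˡ C.equality) (≈-sym assoc))

  record Image {A B} (f : A ⇒ B) : Set (o ⊔ ℓ ⊔ e) where
    field
      obj     : Obj
      cover   : A ⇒ obj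
      arr     : obj ⇒ B
      factors : arr ∘ cover ≈ f
      regular : IsRegularEpi cover
      mono    : IsMono arr

  image : ∀ {A B} (f : A ⇒ B) → Image f
  image f = record
    { obj     = Q.obj
    ; cover   = Q.arr
    ; arr     = m
    ; factors = CQ.universal
    ; regular = regular
    ; mono    = mono
    }
    where
    module K = Pullback (pullback f f)
    module Q = Coequalizer (kernelPair-coequalizer K.isPullback)
    module CQ = IsCoequalizer Q.isCoequalizer

    m : Q.obj ⇒ _
    m = CQ.coequalize K.commute

    regular : IsRegularEpi Q.arr
    regular = _ , _ , _ , Q.isCoequalizer

    mono : IsMono m
    mono u v eq =
      regularEpi⇒epi (regularEpi-stable U.isPullback regular)
        (regularEpi⇒epi (regularEpi-stable V.isPullback regular) (begin
          (u ∘ U.p₂) ∘ V.p₂         ≈⟨ ∘-congʳ U.commute ⟨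
          (Q.arr ∘ U.p₁) ∘ V.p₂     ≈⟨ assoc ⟩
          Q.arr ∘ U.p₁ ∘ V.p₂       ≈⟨ ∘-congˡ K.p₁∘univ≈h₁ ⟨
          Q.arr ∘ K.p₁ ∘ k          ≈⟨ assoc ⟨
          (Q.arr ∘ K.p₁) ∘ k        ≈⟨ ∘-congʳ CQ.equality ⟩
          (Q.arr ∘ K.p₂) ∘ k        ≈⟨ assoc ⟩
          Q.arr ∘ K.p₂ ∘ k          ≈⟨ ∘-congˡ K.p₂∘univ≈h₂ ⟩
          Q.arr ∘ V.p₁              ≈⟨ V.commute ⟩
          (v ∘ U.p₂) ∘ V.p₂         ∎))
      where
      module U = Pullback (pullback Q.arr u)
      module V = Pullback (pullback Q.arr (v ∘ U.p₂))

      same : f ∘ (U.p₁ ∘ V.p₂) ≈ f ∘ V.p₁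
      same = begin
        f ∘ U.p₁ ∘ V.p₂             ≈⟨ ∘-congʳ CQ.universal ⟨
        (m ∘ Q.arr) ∘ U.p₁ ∘ V.p₂   ≈⟨ assoc ⟩
        m ∘ Q.arr ∘ U.p₁ ∘ V.p₂     ≈⟨ ∘-congˡ (pullˡ U.commute) ⟩
        m ∘ (u ∘ U.p₂) ∘ V.p₂       ≈⟨ ∘-congˡ assoc ⟩
        m ∘ u ∘ U.p₂ ∘ V.p₂         ≈⟨ pullˡ eq ⟩
        (m ∘ v) ∘ U.p₂ ∘ V.p₂       ≈⟨ assoc ⟩
        m ∘ v ∘ U.p₂ ∘ V.p₂         ≈⟨ ∘-congˡ assoc ⟨
        m ∘ (v ∘ U.p₂) ∘ V.p₂       ≈⟨ ∘-congˡ V.commute ⟨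
        m ∘ Q.arr ∘ V.p₁            ≈⟨ pullˡ CQ.universal ⟩
        f ∘ V.p₁                    ∎

      k : V.P ⇒ K.P
      k = K.universal same

------------------------------------------------------------------------
-- Subobjects and relations

module Relations {o ℓ e} (R : RegularCategory o ℓ e) where
  open RegularCategory R
  open RegularCategoryProperties R

  -- Without η (and with relations built by copatterns), terms such as x ⨟ y
  -- stay folded during conversion checking.
  record Subobject (A : Obj) : Set (o ⊔ ℓ ⊔ e) where
    no-eta-equality
    field
      dom  : Obj
      arr  : dom ⇒ A
      mono : IsMono arr

  open Subobject

  infix 4 _⊆_ _≅_ _∋_

  -- The generalized element a : T ⇒ A belongs to x if it factors through x.
  _∋_ : ∀ {A T} → Subobject A → T ⇒ A → Set (ℓ ⊔ e)
  x ∋ a = ∃[ h ] arr x ∘ h ≈ a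

  _⊆_ : ∀ {A} → Subobject A → Subobject A → Set (ℓ ⊔ e)
  x ⊆ y = y ∋ arr x

  -- Isomorphism over A; this is the equality of subobjects.
  record _≅_ {A} (x y : Subobject A) : Set (ℓ ⊔ e) where
    field
      from    : dom x ⇒ dom y
      to      : dom y ⇒ dom x
      isoˡ    : to ∘ from ≈ id
      isoʳ    : from ∘ to ≈ id
      commute : arr y ∘ from ≈ arr x

  ∋-resp : ∀ {A T} (x : Subobject A) {a b : T ⇒ A} → a ≈ b → x ∋ a → x ∋ b
  ∋-resp _ p (h , q) = h , ≈-trans q p

  ∋-∘ : ∀ {A T S} (x : Subobject A) {a : T ⇒ A} (k : S ⇒ T) → x ∋ a → x ∋ a ∘ k
  ∋-∘ _ k (h , p) = h ∘ k , pullˡ p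

  ∋-⊆ : ∀ {A T} (x y : Subobject A) {a : T ⇒ A} → x ⊆ y → x ∋ a → y ∋ a
  ∋-⊆ x y (k , q) (h , p) = k ∘ h , ≈-trans (pullˡ q) p

  ∋-local : ∀ {A T S} (x : Subobject A) {a : T ⇒ A} {q : S ⇒ T} →
            IsRegularEpi q → x ∋ a ∘ q → x ∋ a
  ∋-local x {a} {q} r@(_ , f , g , c) (h , p) =
    C.coequalize eq ,
    regularEpi⇒epi r (≈-trans (pullʳ C.universal) p)
    where
    module C = IsCoequalizer c
    eq : h ∘ f ≈ h ∘ g
    eq = mono x (h ∘ f) (h ∘ g) (begin
      arr x ∘ h ∘ f   ≈⟨ pullˡ p ⟩
      (a ∘ q) ∘ f     ≈⟨ pullʳ C.equality ⟩
      a ∘ q ∘ g       ≈⟨ assoc ⟨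
      (a ∘ q) ∘ g     ≈⟨ pullˡ p ⟨
      arr x ∘ h ∘ g   ∎)

  ⊆-refl : ∀ {A} (x : Subobject A) → x ⊆ x
  ⊆-refl x = id , identityʳ

  ⊆-antisym : ∀ {A} {x y : Subobject A} → x ⊆ y → y ⊆ x → x ≅ y
  ⊆-antisym {_} {x} {y} (h , p) (k , q) = record
    { from    = h
    ; to      = k
    ; isoˡ    = mono x _ _ (≈-trans (pullˡ q) (≈-trans p (≈-sym identityʳ)))
    ; isoʳ    = mono y _ _ (≈-trans (pullˡ p) (≈-trans q (≈-sym identityʳ)))
    ; commute = p
    }

  ≅⇒⊆ : ∀ {A} {x y : Subobject A} → x ≅ y → x ⊆ y
  ≅⇒⊆ i = _≅_.from i , _≅_.commute i

  ≅⇒⊇ : ∀ {A} {x y : Subobject A} → x ≅ y → y ⊆ x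
  ≅⇒⊇ {_} {x} {y} i = I.to ,
    ≈-trans (∘-congʳ (≈-sym I.commute)) (≈-trans (pullʳ I.isoʳ) identityʳ)
    where module I = _≅_ i

  subobjects : Obj → Poset (o ⊔ ℓ ⊔ e) (ℓ ⊔ e) (ℓ ⊔ e)
  subobjects A = record
    { Carrier        = Subobject A
    ; _≈_            = _≅_
    ; _≤_            = _⊆_
    ; isPartialOrder = record
      { isPreorder = record
        { isEquivalence = record
          { refl  = λ {x} → ⊆-antisym (⊆-refl x) (⊆-refl x)
          ; sym   = λ i → ⊆-antisym (≅⇒⊇ i) (≅⇒⊆ i)
          ; trans = λ {x} {y} {z} i j →
                    ⊆-antisym (∋-⊆ y z (≅⇒⊆ j) (≅⇒⊆ i)) (∋-⊆ y x (≅⇒⊇ i) (≅⇒⊇ j))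
          }
        ; reflexive = ≅⇒⊆
        ; trans     = λ {x} {y} {z} p q → ∋-⊆ y z q p
        }
      ; antisym = ⊆-antisym
      }
    }

  Relation : Obj → Obj → Set (o ⊔ ℓ ⊔ e)
  Relation r s = Subobject (r ×ₒ s)

  ⊆-intro : ∀ {r s} {x y : Relation r s} →
            (∀ {T} {a : T ⇒ r} {b : T ⇒ s} → x ∋ ⟨ a , b ⟩ → y ∋ ⟨ a , b ⟩) → x ⊆ y
  ⊆-intro {_} {_} {x} {y} f =
    ∋-resp y ×-η (f (∋-resp x (≈-sym ×-η) (⊆-refl x)))

  ∋-resp₂ : ∀ {r s T} (x : Relation r s) {a a′ : T ⇒ r} {b b′ : T ⇒ s} →
            a ≈ a′ → b ≈ b′ → x ∋ ⟨ a , b ⟩ → x ∋ ⟨ a′ , b′ ⟩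
  ∋-resp₂ x p q = ∋-resp x (⟨⟩-cong p q)

  graph : ∀ {r s} → r ⇒ s → Relation r s
  graph {r} f .dom        = r
  graph f     .arr        = ⟨ id , f ⟩
  graph f     .mono h k p = ≈-trans (≈-sym identityˡ) (≈-trans
    (⟨⟩-inj₁ (≈-trans (≈-sym ⟨⟩∘) (≈-trans p ⟨⟩∘))) identityˡ)

  graph-intro : ∀ {r s T} {f : r ⇒ s} {a : T ⇒ r} {b : T ⇒ s} →
                f ∘ a ≈ b → graph f ∋ ⟨ a , b ⟩
  graph-intro {a = a} p = a , ≈-trans ⟨⟩∘ (⟨⟩-cong identityˡ p)

  graph-elim : ∀ {r s T} {f : r ⇒ s} {a : T ⇒ r} {b : T ⇒ s} →
               graph f ∋ ⟨ a , b ⟩ → f ∘ a ≈ b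
  graph-elim (h , p) = ≈-trans
    (∘-congˡ (≈-trans (≈-sym (⟨⟩-inj₁ p′)) identityˡ))
    (⟨⟩-inj₂ p′)
    where p′ = ≈-trans (≈-sym ⟨⟩∘) p

  module Composite {r s t} (x : Relation r s) (y : Relation s t) where
    module P = Pullback (pullback (π₂ ∘ arr x) (π₁ ∘ arr y))
    module I = Image (image ⟨ (π₁ ∘ arr x) ∘ P.p₁ , (π₂ ∘ arr y) ∘ P.p₂ ⟩)

  infixl 7 _⨟_
  _⨟_ : ∀ {r s t} → Relation r s → Relation s t → Relation r t
  (x ⨟ y) .dom  = Composite.I.obj x y
  (x ⨟ y) .arr  = Composite.I.arr x y
  (x ⨟ y) .mono = Composite.I.mono x y

  ⨟-intro : ∀ {r s t T} (x : Relation r s) (y : Relation s t)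
            {a : T ⇒ r} {b : T ⇒ s} {c : T ⇒ t} →
            x ∋ ⟨ a , b ⟩ → y ∋ ⟨ b , c ⟩ → x ⨟ y ∋ ⟨ a , c ⟩
  ⨟-intro {T = T} x y {a} {b} {c} (h , p) (k , q) = I.cover ∘ u , (begin
    I.arr ∘ I.cover ∘ u                                      ≈⟨ pullˡ I.factors ⟩
    ⟨ (π₁ ∘ arr x) ∘ P.p₁ , (π₂ ∘ arr y) ∘ P.p₂ ⟩ ∘ u        ≈⟨ ⟨⟩∘ ⟩
    ⟨ ((π₁ ∘ arr x) ∘ P.p₁) ∘ u , ((π₂ ∘ arr y) ∘ P.p₂) ∘ u ⟩
      ≈⟨ ⟨⟩-cong (≈-trans (pullʳ P.p₁∘univ≈h₁) (≈-trans (pullʳ p) project₁))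
                 (≈-trans (pullʳ P.p₂∘univ≈h₂) (≈-trans (pullʳ q) project₂)) ⟩
    ⟨ a , c ⟩                                                ∎)
    where
    open Composite x y
    u : T ⇒ P.P
    u = P.universal (≈-trans (≈-trans (pullʳ p) project₂)
                             (≈-sym (≈-trans (pullʳ q) project₁)))

  -- Membership is local for regular epis (∋-local), so the middle element of a
  -- composite, which exists only on a cover q, may be used freely.
  ⨟-elim : ∀ {r s t T A} {x : Relation r s} {y : Relation s t} (z : Subobject A)
           {a : T ⇒ r} {c : T ⇒ t} {d : T ⇒ A} →
           (∀ {S} (q : S ⇒ T) {b : S ⇒ s} →
              x ∋ ⟨ a ∘ q , b ⟩ → y ∋ ⟨ b , c ∘ q ⟩ → z ∋ d ∘ q) →
           x ⨟ y ∋ ⟨ a , c ⟩ → z ∋ d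
  ⨟-elim {x = x} {y} z {a} {c} f (h , p) =
    ∋-local z (regularEpi-stable Q.isPullback I.regular)
      (f Q.p₂
        (P.p₁ ∘ Q.p₁ , ×-ext
          (≈-trans (≈-sym (≈-trans assoc assoc)) (≈-trans (⟨⟩-inj₁ eq) (≈-sym project₁)))
          (≈-sym project₂))
        (P.p₂ ∘ Q.p₁ , ×-ext
          (≈-trans (≈-sym assoc) (≈-trans (≈-sym assoc) (≈-trans (≈-sym (∘-congʳ P.commute))
            (≈-trans (pullʳ ≈-refl) (≈-trans assoc (≈-sym project₁))))))
          (≈-trans (≈-sym (≈-trans assoc assoc)) (≈-trans (⟨⟩-inj₂ eq) (≈-sym project₂)))))
    where
    open Composite x y
    module Q = Pullback (pullback I.cover h)
    eq : ⟨ ((π₁ ∘ arr x) ∘ P.p₁) ∘ Q.p₁ , ((π₂ ∘ arr y) ∘ P.p₂) ∘ Q.p₁ ⟩ ≈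
         ⟨ a ∘ Q.p₂ , c ∘ Q.p₂ ⟩
    eq = begin
      ⟨ ((π₁ ∘ arr x) ∘ P.p₁) ∘ Q.p₁ , ((π₂ ∘ arr y) ∘ P.p₂) ∘ Q.p₁ ⟩   ≈⟨ ⟨⟩∘ ⟨
      ⟨ (π₁ ∘ arr x) ∘ P.p₁ , (π₂ ∘ arr y) ∘ P.p₂ ⟩ ∘ Q.p₁   ≈⟨ ∘-congʳ I.factors ⟨
      (I.arr ∘ I.cover) ∘ Q.p₁                               ≈⟨ pullʳ Q.commute ⟩
      I.arr ∘ h ∘ Q.p₂                                       ≈⟨ pullˡ p ⟩
      ⟨ a , c ⟩ ∘ Q.p₂                                       ≈⟨ ⟨⟩∘ ⟩
      ⟨ a ∘ Q.p₂ , c ∘ Q.p₂ ⟩                                ∎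

  ∋-∘₂ : ∀ {r s T S} (x : Relation r s) {a : T ⇒ r} {b : T ⇒ s} (k : S ⇒ T) →
         x ∋ ⟨ a , b ⟩ → x ∋ ⟨ a ∘ k , b ∘ k ⟩
  ∋-∘₂ x k p = ∋-resp x ⟨⟩∘ (∋-∘ x k p)

  ⨟-elim₂ : ∀ {r s t r′ t′ T} {x : Relation r s} {y : Relation s t} (z : Relation r′ t′)
            {a : T ⇒ r} {c : T ⇒ t} {a′ : T ⇒ r′} {c′ : T ⇒ t′} →
            (∀ {S} (q : S ⇒ T) {b : S ⇒ s} →
               x ∋ ⟨ a ∘ q , b ⟩ → y ∋ ⟨ b , c ∘ q ⟩ → z ∋ ⟨ a′ ∘ q , c′ ∘ q ⟩) →
            x ⨟ y ∋ ⟨ a , c ⟩ → z ∋ ⟨ a′ , c′ ⟩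
  ⨟-elim₂ {x = x} {y} z f = ⨟-elim {x = x} {y} z (λ q m n → ∋-resp z (≈-sym ⟨⟩∘) (f q m n))

  module _ {r s t} (f : r ⇒ s) (x : Relation s t) {T} {a : T ⇒ r} {c : T ⇒ t} where

    graph⨟-elim : graph f ⨟ x ∋ ⟨ a , c ⟩ → x ∋ ⟨ f ∘ a , c ⟩
    graph⨟-elim = ⨟-elim₂ {x = graph f} {x} x (λ _ m n →
      ∋-resp₂ x (≈-trans (≈-sym (graph-elim m)) (≈-sym assoc)) ≈-refl n)

    graph⨟-intro : x ∋ ⟨ f ∘ a , c ⟩ → graph f ⨟ x ∋ ⟨ a , c ⟩
    graph⨟-intro = ⨟-intro (graph f) x (graph-intro ≈-refl)

  ⨟graph-elim : ∀ {r s t T} {f : s ⇒ t} {f⁻¹ : t ⇒ s} → f⁻¹ ∘ f ≈ id →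
                (x : Relation r s) {a : T ⇒ r} {c : T ⇒ t} →
                x ⨟ graph f ∋ ⟨ a , c ⟩ → x ∋ ⟨ a , f⁻¹ ∘ c ⟩
  ⨟graph-elim {f = f} p x = ⨟-elim₂ {x = x} {graph f} x (λ _ m n →
    ∋-resp₂ x ≈-refl (≈-trans (≈-sym identityˡ) (≈-trans (∘-congʳ (≈-sym p))
      (≈-trans (pullʳ (graph-elim n)) (≈-sym assoc)))) m)

  ⨟graph-intro : ∀ {r s t T} {f : s ⇒ t} {f⁻¹ : t ⇒ s} → f ∘ f⁻¹ ≈ id →
                 (x : Relation r s) {a : T ⇒ r} {c : T ⇒ t} →
                 x ∋ ⟨ a , f⁻¹ ∘ c ⟩ → x ⨟ graph f ∋ ⟨ a , c ⟩
  ⨟graph-intro {f = f} p x m =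
    ⨟-intro x (graph f) m (graph-intro (≈-trans (pullˡ p) identityˡ))

  interleave : ∀ {X Y r s r′ s′} → X ⇒ r ×ₒ s → Y ⇒ r′ ×ₒ s′ →
               X ×ₒ Y ⇒ (r ×ₒ r′) ×ₒ (s ×ₒ s′)
  interleave f g = ⟨ ⟨ π₁ ∘ f ∘ π₁ , π₁ ∘ g ∘ π₂ ⟩ , ⟨ π₂ ∘ f ∘ π₁ , π₂ ∘ g ∘ π₂ ⟩ ⟩

  interleave-∘ : ∀ {T X Y r s r′ s′} {f : X ⇒ r ×ₒ s} {g : Y ⇒ r′ ×ₒ s′} {h : T ⇒ X ×ₒ Y} →
                 interleave f g ∘ h ≈
                 ⟨ ⟨ π₁ ∘ f ∘ π₁ ∘ h , π₁ ∘ g ∘ π₂ ∘ h ⟩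
                 , ⟨ π₂ ∘ f ∘ π₁ ∘ h , π₂ ∘ g ∘ π₂ ∘ h ⟩ ⟩
  interleave-∘ = ≈-trans ⟨⟩∘ (⟨⟩-cong
    (≈-trans ⟨⟩∘ (⟨⟩-cong (pullʳ assoc) (pullʳ assoc)))
    (≈-trans ⟨⟩∘ (⟨⟩-cong (pullʳ assoc) (pullʳ assoc))))

  infixr 8 _⊗_
  _⊗_ : ∀ {r s r′ s′} → Relation r s → Relation r′ s′ → Relation (r ×ₒ r′) (s ×ₒ s′)
  (x ⊗ y) .dom        = dom x ×ₒ dom y
  (x ⊗ y) .arr        = interleave (arr x) (arr y)
  (x ⊗ y) .mono h k p =
    ×-ext (mono x _ _ (×-ext (⟨⟩-inj₁ p₁) (⟨⟩-inj₁ p₂)))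
          (mono y _ _ (×-ext (⟨⟩-inj₂ p₁) (⟨⟩-inj₂ p₂)))
    where
    p′ = ≈-trans (≈-sym interleave-∘) (≈-trans p interleave-∘)
    p₁ = ⟨⟩-inj₁ p′
    p₂ = ⟨⟩-inj₂ p′

  ⊗-intro : ∀ {r s r′ s′ T} (x : Relation r s) (y : Relation r′ s′)
            {u : T ⇒ r ×ₒ r′} {v : T ⇒ s ×ₒ s′} →
            x ∋ ⟨ π₁ ∘ u , π₁ ∘ v ⟩ → y ∋ ⟨ π₂ ∘ u , π₂ ∘ v ⟩ → x ⊗ y ∋ ⟨ u , v ⟩
  ⊗-intro x y {u} {v} (h , p) (k , q) = ⟨ h , k ⟩ , ≈-trans interleave-∘ (⟨⟩-cong
    (unique (≈-sym (≈-trans (∘-congˡ p′) project₁)) (≈-sym (≈-trans (∘-congˡ q′) project₁)))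
    (unique (≈-sym (≈-trans (∘-congˡ p′) project₂)) (≈-sym (≈-trans (∘-congˡ q′) project₂))))
    where
    p′ : arr x ∘ π₁ ∘ ⟨ h , k ⟩ ≈ ⟨ π₁ ∘ u , π₁ ∘ v ⟩
    p′ = ≈-trans (∘-congˡ project₁) p
    q′ : arr y ∘ π₂ ∘ ⟨ h , k ⟩ ≈ ⟨ π₂ ∘ u , π₂ ∘ v ⟩
    q′ = ≈-trans (∘-congˡ project₂) q

  ⊗-elim : ∀ {r s r′ s′ T} (x : Relation r s) (y : Relation r′ s′)
           {u : T ⇒ r ×ₒ r′} {v : T ⇒ s ×ₒ s′} →
           x ⊗ y ∋ ⟨ u , v ⟩ → x ∋ ⟨ π₁ ∘ u , π₁ ∘ v ⟩ × y ∋ ⟨ π₂ ∘ u , π₂ ∘ v ⟩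
  ⊗-elim x y {u} {v} (h , p) =
    (π₁ ∘ h , ≈-sym (unique (≈-trans (≈-sym project₁) (∘-congˡ (≈-sym pu)))
                            (≈-trans (≈-sym project₁) (∘-congˡ (≈-sym pv))))) ,
    (π₂ ∘ h , ≈-sym (unique (≈-trans (≈-sym project₂) (∘-congˡ (≈-sym pu)))
                            (≈-trans (≈-sym project₂) (∘-congˡ (≈-sym pv)))))
    where
    p′ = ≈-trans (≈-sym p) interleave-∘
    pu = ⟨⟩-inj₁ p′
    pv = ⟨⟩-inj₂ p′

  Rel-poCategory : PoCategory o (o ⊔ ℓ ⊔ e) (ℓ ⊔ e) (ℓ ⊔ e)
  Rel-poCategory = record
    { Obj       = Obj
    ; Hom       = λ r s → subobjects (r ×ₒ s)
    ; id        = graph id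
    ; _⨟_       = _⨟_
    ; ⨟-mono    = λ {_} {_} {_} {x} {x′} {y} {y′} p q →
        ⊆-intro {x = x ⨟ y} {x′ ⨟ y′} (⨟-elim₂ {x = x} {y} (x′ ⨟ y′) (λ _ m n →
          ⨟-intro x′ y′ (∋-⊆ x x′ p m) (∋-⊆ y y′ q n)))
    ; assoc     = λ {_} {_} {_} {_} {x} {y} {z} → ⊆-antisym
        (⊆-intro {x = (x ⨟ y) ⨟ z} {x ⨟ (y ⨟ z)}
          (⨟-elim₂ {x = x ⨟ y} {z} (x ⨟ (y ⨟ z)) (λ _ m n →
            ⨟-elim₂ {x = x} {y} (x ⨟ (y ⨟ z)) (λ k m′ n′ →
              ⨟-intro x (y ⨟ z) m′ (⨟-intro y z n′ (∋-∘₂ z k n))) m)))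
        (⊆-intro {x = x ⨟ (y ⨟ z)} {(x ⨟ y) ⨟ z}
          (⨟-elim₂ {x = x} {y ⨟ z} ((x ⨟ y) ⨟ z) (λ _ m n →
            ⨟-elim₂ {x = y} {z} ((x ⨟ y) ⨟ z) (λ k m′ n′ →
              ⨟-intro (x ⨟ y) z (⨟-intro x y (∋-∘₂ x k m) m′) n′) n)))
    ; identityˡ = λ {_} {_} {x} → ⊆-antisym
        (⊆-intro {x = graph id ⨟ x} {x} (λ m →
          ∋-resp₂ x identityˡ ≈-refl (graph⨟-elim id x m)))
        (⊆-intro {x = x} {graph id ⨟ x} (λ m →
          graph⨟-intro id x (∋-resp₂ x (≈-sym identityˡ) ≈-refl m)))
    ; identityʳ = λ {_} {_} {x} → ⊆-antisym
        (⊆-intro {x = x ⨟ graph id} {x} (λ m →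
          ∋-resp₂ x ≈-refl identityˡ (⨟graph-elim identityˡ x m)))
        (⊆-intro {x = x} {x ⨟ graph id} (λ m →
          ⨟graph-intro identityˡ x (∋-resp₂ x ≈-refl (≈-sym identityˡ) m)))
    }

  open PoCategory Rel-poCategory using (⨟-mono) renaming (_≅_ to _≅ᵣ_)
  module Sub {A : Obj} = Poset (subobjects A)

  ⨟-cong : ∀ {r s t} {x x′ : Relation r s} {y y′ : Relation s t} →
           x ≅ x′ → y ≅ y′ → x ⨟ y ≅ x′ ⨟ y′
  ⨟-cong {x = x} {x′} {y} {y′} p q = ⊆-antisym
    (⨟-mono {f = x} {x′} {y} {y′} (≅⇒⊆ p) (≅⇒⊆ q))
    (⨟-mono {f = x′} {x} {y′} {y} (≅⇒⊇ p) (≅⇒⊇ q))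

  ⊗-mono : ∀ {r s r′ s′} {x x′ : Relation r s} {y y′ : Relation r′ s′} →
           x ⊆ x′ → y ⊆ y′ → x ⊗ y ⊆ x′ ⊗ y′
  ⊗-mono {x = x} {x′} {y} {y′} p q = ⊆-intro {x = x ⊗ y} {x′ ⊗ y′} (λ m →
    ⊗-intro x′ y′ (∋-⊆ x x′ p (proj₁ (⊗-elim x y m))) (∋-⊆ y y′ q (proj₂ (⊗-elim x y m))))

  ⊗-cong : ∀ {r s r′ s′} {x x′ : Relation r s} {y y′ : Relation r′ s′} →
           x ≅ x′ → y ≅ y′ → x ⊗ y ≅ x′ ⊗ y′
  ⊗-cong {x = x} {x′} {y} {y′} p q = ⊆-antisym
    (⊗-mono {x = x} {x′} {y} {y′} (≅⇒⊆ p) (≅⇒⊆ q))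
    (⊗-mono {x = x′} {x} {y′} {y} (≅⇒⊇ p) (≅⇒⊇ q))

  ⊗-⨟ : ∀ {r s t r′ s′ t′} (x : Relation r s) (y : Relation s t)
        (x′ : Relation r′ s′) (y′ : Relation s′ t′) →
        (x ⨟ y) ⊗ (x′ ⨟ y′) ≅ (x ⊗ x′) ⨟ (y ⊗ y′)
  ⊗-⨟ x y x′ y′ = ⊆-antisym
    (⊆-intro {x = l} {r} (λ m →
      ⨟-elim₂ {x = x} {y} r (λ k m₁ n₁ →
        ⨟-elim₂ {x = x′} {y′} r (λ k′ m₂ n₂ →
          ⨟-intro (x ⊗ x′) (y ⊗ y′)
            (⊗-intro x x′
              (∋-resp₂ x (≈-trans assoc (≈-trans assoc (∘-congˡ (≈-sym assoc)))) (≈-sym project₁) (∋-∘₂ x k′ m₁))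
              (∋-resp₂ x′ (≈-trans (∘-congʳ assoc) assoc) (≈-sym project₂) m₂))
            (⊗-intro y y′
              (∋-resp₂ y (≈-sym project₁) (≈-trans assoc (≈-trans assoc (∘-congˡ (≈-sym assoc)))) (∋-∘₂ y k′ n₁))
              (∋-resp₂ y′ (≈-sym project₂) (≈-trans (∘-congʳ assoc) assoc) n₂)))
          (∋-resp₂ (x′ ⨟ y′) ≈-refl ≈-refl (∋-∘₂ (x′ ⨟ y′) k (proj₂ (⊗-elim (x ⨟ y) (x′ ⨟ y′) m)))))
        (proj₁ (⊗-elim (x ⨟ y) (x′ ⨟ y′) m))))
    (⊆-intro {x = r} {l} (⨟-elim₂ {x = x ⊗ x′} {y ⊗ y′} l (λ _ m n →
      ⊗-intro (x ⨟ y) (x′ ⨟ y′)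
        (⨟-intro x y (proj₁ (⊗-elim x x′ m)) (proj₁ (⊗-elim y y′ n)))
        (⨟-intro x′ y′ (proj₂ (⊗-elim x x′ m)) (proj₂ (⊗-elim y y′ n))))))
    where
    l = (x ⨟ y) ⊗ (x′ ⨟ y′)
    r = (x ⊗ x′) ⨟ (y ⊗ y′)

  -- The coherence isomorphisms are the graphs of those of the cartesian
  -- structure.

  infixr 8 _×₁_
  _×₁_ : ∀ {A B A′ B′} → A ⇒ B → A′ ⇒ B′ → A ×ₒ A′ ⇒ B ×ₒ B′
  f ×₁ g = ⟨ f ∘ π₁ , g ∘ π₂ ⟩

  ×₁-⟨⟩ : ∀ {A B A′ B′ T} {f : A ⇒ B} {g : A′ ⇒ B′} {a : T ⇒ A} {a′ : T ⇒ A′}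
          {b : T ⇒ B} {b′ : T ⇒ B′} → f ∘ a ≈ b → g ∘ a′ ≈ b′ →
          (f ×₁ g) ∘ ⟨ a , a′ ⟩ ≈ ⟨ b , b′ ⟩
  ×₁-⟨⟩ p q = ≈-trans ⟨⟩∘ (⟨⟩-cong (≈-trans (pullʳ project₁) p) (≈-trans (pullʳ project₂) q))

  graph-cong : ∀ {r s} {f g : r ⇒ s} → f ≈ g → graph f ≅ graph g
  graph-cong {f = f} {g} p = ⊆-antisym
    (⊆-intro {x = graph f} {graph g} (λ m →
      graph-intro (≈-trans (∘-congʳ (≈-sym p)) (graph-elim m))))
    (⊆-intro {x = graph g} {graph f} (λ m →
      graph-intro (≈-trans (∘-congʳ p) (graph-elim m))))

  graph-⨟ : ∀ {r s t} {x : Relation r s} {y : Relation s t} {f : r ⇒ s} {g : s ⇒ t} →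
            x ≅ graph f → y ≅ graph g → x ⨟ y ≅ graph (g ∘ f)
  graph-⨟ {f = f} {g} p q = Sub.Eq.trans (⨟-cong p q) (⊆-antisym
    (⊆-intro {x = graph f ⨟ graph g} {graph (g ∘ f)} (λ m →
      graph-intro (≈-trans assoc (graph-elim (graph⨟-elim f (graph g) m)))))
    (⊆-intro {x = graph (g ∘ f)} {graph f ⨟ graph g} (λ m →
      graph⨟-intro f (graph g) (graph-intro (≈-trans (≈-sym assoc) (graph-elim m))))))

  graph-⊗ : ∀ {r s r′ s′} {x : Relation r s} {y : Relation r′ s′} {f : r ⇒ s} {g : r′ ⇒ s′} →
            x ≅ graph f → y ≅ graph g → x ⊗ y ≅ graph (f ×₁ g)
  graph-⊗ {f = f} {g} p q = Sub.Eq.trans (⊗-cong p q) (⊆-antisym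
    (⊆-intro {x = graph f ⊗ graph g} {graph (f ×₁ g)} (λ m →
      let m₁ , m₂ = ⊗-elim (graph f) (graph g) m in
      graph-intro (≈-trans (∘-congˡ (≈-sym ×-η))
        (≈-trans (×₁-⟨⟩ (graph-elim m₁) (graph-elim m₂)) ×-η))))
    (⊆-intro {x = graph (f ×₁ g)} {graph f ⊗ graph g} (λ m →
      ⊗-intro (graph f) (graph g)
        (graph-intro (≈-trans (≈-sym (pullʳ ≈-refl)) (≈-trans (≈-sym (∘-congʳ project₁))
          (pullʳ (graph-elim m)))))
        (graph-intro (≈-trans (≈-sym (pullʳ ≈-refl)) (≈-trans (≈-sym (∘-congʳ project₂))
          (pullʳ (graph-elim m))))))))

  graph-iso : ∀ {r s} (f : r ⇒ s) (g : s ⇒ r) → g ∘ f ≈ id → f ∘ g ≈ id → r ≅ᵣ s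
  graph-iso f g p q = record
    { from = graph f
    ; to   = graph g
    ; isoˡ = Sub.Eq.trans (graph-⨟ Sub.Eq.refl Sub.Eq.refl) (graph-cong p)
    ; isoʳ = Sub.Eq.trans (graph-⨟ Sub.Eq.refl Sub.Eq.refl) (graph-cong q)
    }

  graph-natural : ∀ {r s r′ s′} (x : Relation r s) (y : Relation r′ s′)
                  {f : r ⇒ r′} {g : s ⇒ s′} {g⁻¹ : s′ ⇒ s} →
                  g⁻¹ ∘ g ≈ id → g ∘ g⁻¹ ≈ id →
                  (∀ {T} {a : T ⇒ r} {b : T ⇒ s} → x ∋ ⟨ a , b ⟩ → y ∋ ⟨ f ∘ a , g ∘ b ⟩) →
                  (∀ {T} {a : T ⇒ r} {b : T ⇒ s} → y ∋ ⟨ f ∘ a , g ∘ b ⟩ → x ∋ ⟨ a , b ⟩) →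
                  x ⨟ graph g ≅ graph f ⨟ y
  graph-natural x y {f} {g} {g⁻¹} p q to from = ⊆-antisym
    (⊆-intro {x = x ⨟ graph g} {graph f ⨟ y} (λ m →
      graph⨟-intro f y (∋-resp₂ y ≈-refl cancel (to (⨟graph-elim p x m)))))
    (⊆-intro {x = graph f ⨟ y} {x ⨟ graph g} (λ m →
      ⨟graph-intro q x (from (∋-resp₂ y ≈-refl (≈-sym cancel) (graph⨟-elim f y m)))))
    where
    cancel : ∀ {T} {c : T ⇒ _} → g ∘ g⁻¹ ∘ c ≈ c
    cancel = ≈-trans (pullˡ q) identityˡ

  assocₒ : ∀ {A B C} → (A ×ₒ B) ×ₒ C ⇒ A ×ₒ (B ×ₒ C)
  assocₒ = ⟨ π₁ ∘ π₁ , ⟨ π₂ ∘ π₁ , π₂ ⟩ ⟩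

  assocₒ⁻¹ : ∀ {A B C} → A ×ₒ (B ×ₒ C) ⇒ (A ×ₒ B) ×ₒ C
  assocₒ⁻¹ = ⟨ ⟨ π₁ , π₁ ∘ π₂ ⟩ , π₂ ∘ π₂ ⟩

  swapₒ : ∀ {A B} → A ×ₒ B ⇒ B ×ₒ A
  swapₒ = ⟨ π₂ , π₁ ⟩

  module _ {A B C T} {a : T ⇒ A} {b : T ⇒ B} {c : T ⇒ C} where

    assocₒ-⟨⟩ : assocₒ ∘ ⟨ ⟨ a , b ⟩ , c ⟩ ≈ ⟨ a , ⟨ b , c ⟩ ⟩
    assocₒ-⟨⟩ = ≈-trans ⟨⟩∘ (⟨⟩-cong (≈-trans (pullʳ project₁) project₁)
      (≈-trans ⟨⟩∘ (⟨⟩-cong (≈-trans (pullʳ project₁) project₂) project₂)))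

    assocₒ⁻¹-⟨⟩ : assocₒ⁻¹ ∘ ⟨ a , ⟨ b , c ⟩ ⟩ ≈ ⟨ ⟨ a , b ⟩ , c ⟩
    assocₒ⁻¹-⟨⟩ = ≈-trans ⟨⟩∘ (⟨⟩-cong
      (≈-trans ⟨⟩∘ (⟨⟩-cong project₁ (≈-trans (pullʳ project₂) project₁)))
      (≈-trans (pullʳ project₂) project₂))

  swapₒ-⟨⟩ : ∀ {A B T} {a : T ⇒ A} {b : T ⇒ B} → swapₒ ∘ ⟨ a , b ⟩ ≈ ⟨ b , a ⟩
  swapₒ-⟨⟩ = ≈-trans ⟨⟩∘ (⟨⟩-cong project₂ project₁)

  infixr 5 _▸_
  _▸_ : ∀ {A B C T} {g : B ⇒ C} {f : A ⇒ B} {a : T ⇒ A} {b : T ⇒ B} {c : T ⇒ C} →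
        f ∘ a ≈ b → g ∘ b ≈ c → (g ∘ f) ∘ a ≈ c
  p ▸ q = ≈-trans (pullʳ p) q

  tuple₂ : ∀ {A B} → ⟨ π₁ , π₂ ⟩ ≈ id {A ×ₒ B}
  tuple₂ = unique identityʳ identityʳ

  tuple₃ : ∀ {A B C} → ⟨ ⟨ π₁ ∘ π₁ , π₂ ∘ π₁ ⟩ , π₂ ⟩ ≈ id {(A ×ₒ B) ×ₒ C}
  tuple₃ = ≈-trans (⟨⟩-cong ×-η ≈-refl) tuple₂

  tuple₃′ : ∀ {A B C} → ⟨ π₁ , ⟨ π₁ ∘ π₂ , π₂ ∘ π₂ ⟩ ⟩ ≈ id {A ×ₒ (B ×ₒ C)}
  tuple₃′ = ≈-trans (⟨⟩-cong ≈-refl ×-η) tuple₂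

  tuple₄ : ∀ {A B C D} →
           ⟨ ⟨ ⟨ π₁ ∘ π₁ ∘ π₁ , π₂ ∘ π₁ ∘ π₁ ⟩ , π₂ ∘ π₁ ⟩ , π₂ ⟩ ≈ id {((A ×ₒ B) ×ₒ C) ×ₒ D}
  tuple₄ = ≈-trans (⟨⟩-cong (⟨⟩-cong ×-η ≈-refl) ≈-refl) tuple₃

  ≈-on : ∀ {A B} {t : A ⇒ A} {u v w : A ⇒ B} → t ≈ id → u ∘ t ≈ w → v ∘ t ≈ w → u ≈ v
  ≈-on {t = t} {u} {v} {w} η p q = begin
    u       ≈⟨ identityʳ ⟨
    u ∘ id  ≈⟨ ∘-congˡ η ⟨
    u ∘ t   ≈⟨ p ⟩
    w       ≈⟨ q ⟨
    v ∘ t   ≈⟨ ∘-congˡ η ⟩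
    v ∘ id  ≈⟨ identityʳ ⟩
    v       ∎

  ≈id-on : ∀ {A} {t u : A ⇒ A} → t ≈ id → u ∘ t ≈ t → u ≈ id
  ≈id-on η p = ≈-on η p identityˡ

  assocₒ⁻¹∘assocₒ : ∀ {A B C} → assocₒ⁻¹ ∘ assocₒ ≈ id {(A ×ₒ B) ×ₒ C}
  assocₒ⁻¹∘assocₒ = ≈id-on tuple₃ (assocₒ-⟨⟩ ▸ assocₒ⁻¹-⟨⟩)

  assocₒ∘assocₒ⁻¹ : ∀ {A B C} → assocₒ ∘ assocₒ⁻¹ ≈ id {A ×ₒ (B ×ₒ C)}
  assocₒ∘assocₒ⁻¹ = ≈id-on tuple₃′ (assocₒ⁻¹-⟨⟩ ▸ assocₒ-⟨⟩)

  swapₒ∘swapₒ : ∀ {A B} → swapₒ ∘ swapₒ ≈ id {A ×ₒ B}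
  swapₒ∘swapₒ = ≈id-on tuple₂ (swapₒ-⟨⟩ ▸ swapₒ-⟨⟩)

  ⟨!,id⟩∘π₂ : ∀ {A} → ⟨ ! , id ⟩ ∘ π₂ ≈ id {𝟙 ×ₒ A}
  ⟨!,id⟩∘π₂ = ≈-trans ⟨⟩∘ (unique !-unique₂ (≈-trans identityʳ (≈-sym identityˡ)))

  ⟨id,!⟩∘π₁ : ∀ {A} → ⟨ id , ! ⟩ ∘ π₁ ≈ id {A ×ₒ 𝟙}
  ⟨id,!⟩∘π₁ = ≈-trans ⟨⟩∘ (unique (≈-trans identityʳ (≈-sym identityˡ)) !-unique₂)

  assocₒ-natural : ∀ {r s r′ s′ r″ s″}
                   (x : Relation r s) (y : Relation r′ s′) (z : Relation r″ s″) →
                   ((x ⊗ y) ⊗ z) ⨟ graph assocₒ ≅ graph assocₒ ⨟ (x ⊗ (y ⊗ z))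
  assocₒ-natural {r} {s} {r′} {s′} {r″} {s″} x y z =
    graph-natural ((x ⊗ y) ⊗ z) (x ⊗ (y ⊗ z))
      {f = assocₒ {r} {r′} {r″}} {g = assocₒ {s} {s′} {s″}} {g⁻¹ = assocₒ⁻¹ {s} {s′} {s″}}
      assocₒ⁻¹∘assocₒ assocₒ∘assocₒ⁻¹ to from
    where
    module _ {A B C T} (a : T ⇒ (A ×ₒ B) ×ₒ C) where
      e₁ : π₁ ∘ assocₒ {A} {B} {C} ∘ a ≈ π₁ ∘ π₁ ∘ a
      e₁ = ≈-trans (pullˡ project₁) assoc
      e₂ : π₁ ∘ π₂ ∘ assocₒ {A} {B} {C} ∘ a ≈ π₂ ∘ π₁ ∘ a
      e₂ = ≈-trans (∘-congˡ (pullˡ project₂)) (≈-trans (pullˡ project₁) assoc)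
      e₃ : π₂ ∘ π₂ ∘ assocₒ {A} {B} {C} ∘ a ≈ π₂ ∘ a
      e₃ = ≈-trans (∘-congˡ (pullˡ project₂)) (pullˡ project₂)

    module _ {T} {a : T ⇒ (r ×ₒ r′) ×ₒ r″} {b : T ⇒ (s ×ₒ s′) ×ₒ s″} where

      to : (x ⊗ y) ⊗ z ∋ ⟨ a , b ⟩ →
           x ⊗ (y ⊗ z) ∋ ⟨ assocₒ {r} {r′} {r″} ∘ a , assocₒ {s} {s′} {s″} ∘ b ⟩
      to m =
        let m₁₂ , m₃ = ⊗-elim (x ⊗ y) z {a} {b} m
            m₁ , m₂ = ⊗-elim x y {π₁ ∘ a} {π₁ ∘ b} m₁₂
        in ⊗-intro x (y ⊗ z) {assocₒ {r} {r′} {r″} ∘ a} {assocₒ {s} {s′} {s″} ∘ b}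
             (∋-resp₂ x (≈-sym (e₁ a)) (≈-sym (e₁ b)) m₁)
             (⊗-intro y z {π₂ ∘ assocₒ {r} {r′} {r″} ∘ a} {π₂ ∘ assocₒ {s} {s′} {s″} ∘ b}
               (∋-resp₂ y (≈-sym (e₂ a)) (≈-sym (e₂ b)) m₂)
               (∋-resp₂ z (≈-sym (e₃ a)) (≈-sym (e₃ b)) m₃))

      from : x ⊗ (y ⊗ z) ∋ ⟨ assocₒ {r} {r′} {r″} ∘ a , assocₒ {s} {s′} {s″} ∘ b ⟩ →
             (x ⊗ y) ⊗ z ∋ ⟨ a , b ⟩
      from m =
        let m₁ , m₂₃ = ⊗-elim x (y ⊗ z) {assocₒ {r} {r′} {r″} ∘ a} {assocₒ {s} {s′} {s″} ∘ b} m
            m₂ , m₃ = ⊗-elim y z {π₂ ∘ assocₒ {r} {r′} {r″} ∘ a}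
                                 {π₂ ∘ assocₒ {s} {s′} {s″} ∘ b} m₂₃
        in ⊗-intro (x ⊗ y) z {a} {b}
             (⊗-intro x y {π₁ ∘ a} {π₁ ∘ b}
               (∋-resp₂ x (e₁ a) (e₁ b) m₁) (∋-resp₂ y (e₂ a) (e₂ b) m₂))
             (∋-resp₂ z (e₃ a) (e₃ b) m₃)

  swapₒ-natural : ∀ {r s r′ s′} (x : Relation r s) (y : Relation r′ s′) →
                  (x ⊗ y) ⨟ graph swapₒ ≅ graph swapₒ ⨟ (y ⊗ x)
  swapₒ-natural {r} {s} {r′} {s′} x y =
    graph-natural (x ⊗ y) (y ⊗ x)
      {f = swapₒ {r} {r′}} {g = swapₒ {s} {s′}} {g⁻¹ = swapₒ {s′} {s}}
      swapₒ∘swapₒ swapₒ∘swapₒ to from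
    where
    module _ {A B T} (a : T ⇒ A ×ₒ B) where
      e₁ : π₁ ∘ swapₒ {A} {B} ∘ a ≈ π₂ ∘ a
      e₁ = pullˡ project₁
      e₂ : π₂ ∘ swapₒ {A} {B} ∘ a ≈ π₁ ∘ a
      e₂ = pullˡ project₂

    module _ {T} {a : T ⇒ r ×ₒ r′} {b : T ⇒ s ×ₒ s′} where

      to : x ⊗ y ∋ ⟨ a , b ⟩ → y ⊗ x ∋ ⟨ swapₒ {r} {r′} ∘ a , swapₒ {s} {s′} ∘ b ⟩
      to m =
        let m₁ , m₂ = ⊗-elim x y {a} {b} m
        in ⊗-intro y x {swapₒ {r} {r′} ∘ a} {swapₒ {s} {s′} ∘ b}
             (∋-resp₂ y (≈-sym (e₁ a)) (≈-sym (e₁ b)) m₂)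
             (∋-resp₂ x (≈-sym (e₂ a)) (≈-sym (e₂ b)) m₁)

      from : y ⊗ x ∋ ⟨ swapₒ {r} {r′} ∘ a , swapₒ {s} {s′} ∘ b ⟩ → x ⊗ y ∋ ⟨ a , b ⟩
      from m =
        let m₁ , m₂ = ⊗-elim y x {swapₒ {r} {r′} ∘ a} {swapₒ {s} {s′} ∘ b} m
        in ⊗-intro x y {a} {b} (∋-resp₂ x (e₂ a) (e₂ b) m₂) (∋-resp₂ y (e₁ a) (e₁ b) m₁)

  π₂-natural : ∀ {r s} (x : Relation r s) →
               (graph (id {𝟙}) ⊗ x) ⨟ graph π₂ ≅ graph π₂ ⨟ x
  π₂-natural {r} {s} x = graph-natural (graph (id {𝟙}) ⊗ x) x
    {f = π₂ {𝟙} {r}} {g = π₂ {𝟙} {s}} {g⁻¹ = ⟨ ! , id ⟩} ⟨!,id⟩∘π₂ project₂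
    (λ {_} {a} {b} m → proj₂ (⊗-elim (graph id) x {a} {b} m))
    (λ {_} {a} {b} m → ⊗-intro (graph id) x {a} {b} (graph-intro !-unique₂) m)

  π₁-natural : ∀ {r s} (x : Relation r s) →
               (x ⊗ graph (id {𝟙})) ⨟ graph π₁ ≅ graph π₁ ⨟ x
  π₁-natural {r} {s} x = graph-natural (x ⊗ graph (id {𝟙})) x
    {f = π₁ {r} {𝟙}} {g = π₁ {s} {𝟙}} {g⁻¹ = ⟨ id , ! ⟩} ⟨id,!⟩∘π₁ project₁
    (λ {_} {a} {b} m → proj₁ (⊗-elim x (graph id) {a} {b} m))
    (λ {_} {a} {b} m → ⊗-intro x (graph id) {a} {b} m (graph-intro !-unique₂))

  coherence : ∀ {r s} {x y : Relation r s} {f g : r ⇒ s} →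
              x ≅ graph f → y ≅ graph g → f ≈ g → x ≅ y
  coherence p q e = Sub.Eq.trans p (Sub.Eq.trans (graph-cong e) (Sub.Eq.sym q))

  private
    γ : ∀ {r s} {f : r ⇒ s} → graph f ≅ graph f
    γ = Sub.Eq.refl

  Rel : SymmetricMonoidalPoCategory o (o ⊔ ℓ ⊔ e) (ℓ ⊔ e) (ℓ ⊔ e)
  Rel = record
    { poCategory = Rel-poCategory
    ; unit       = 𝟙
    ; ⊗          = record
      { F₀           = λ (r , s) → r ×ₒ s
      ; F₁           = λ (x , y) → x ⊗ y
      ; mono         = λ {_} {_} {(x , y)} {(x′ , y′)} (p , q) →
                       ⊗-mono {x = x} {x′} {y} {y′} p q
      ; identity     = coherence (graph-⊗ γ γ) γ
                         (unique (≈-trans identityʳ (≈-sym identityˡ))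
                                 (≈-trans identityʳ (≈-sym identityˡ)))
      ; homomorphism = λ {_} {_} {_} {(x , x′)} {(y , y′)} → ⊗-⨟ x y x′ y′
      }
    ; associator = λ _ _ _ → graph-iso assocₒ assocₒ⁻¹ assocₒ⁻¹∘assocₒ assocₒ∘assocₒ⁻¹
    ; unitorˡ    = λ _ → graph-iso π₂ ⟨ ! , id ⟩ ⟨!,id⟩∘π₂ project₂
    ; unitorʳ    = λ _ → graph-iso π₁ ⟨ id , ! ⟩ ⟨id,!⟩∘π₁ project₁
    ; σ          = λ _ _ → graph swapₒ
    ; α-natural  = assocₒ-natural
    ; λ-natural  = π₂-natural
    ; ρ-natural  = π₁-natural
    ; σ-natural  = swapₒ-natural
    ; triangle   = λ _ _ → coherence (graph-⨟ γ (graph-⊗ γ γ)) (graph-⊗ γ γ)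
        (≈-on tuple₃ (assocₒ-⟨⟩ ▸ ×₁-⟨⟩ identityˡ project₂) (×₁-⟨⟩ project₁ identityˡ))
    ; pentagon   = λ _ _ _ _ → coherence (graph-⨟ γ γ)
        (graph-⨟ (graph-⨟ (graph-⊗ γ γ) γ) (graph-⊗ γ γ))
        (≈-on tuple₄ (assocₒ-⟨⟩ ▸ assocₒ-⟨⟩)
          ((×₁-⟨⟩ assocₒ-⟨⟩ identityˡ ▸ assocₒ-⟨⟩) ▸ ×₁-⟨⟩ identityˡ assocₒ-⟨⟩))
    ; hexagon    = λ _ _ _ → coherence (graph-⨟ (graph-⨟ γ γ) γ)
        (graph-⨟ (graph-⨟ (graph-⊗ γ γ) γ) (graph-⊗ γ γ))
        (≈-on tuple₃ ((assocₒ-⟨⟩ ▸ swapₒ-⟨⟩) ▸ assocₒ-⟨⟩)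
          ((×₁-⟨⟩ swapₒ-⟨⟩ identityˡ ▸ assocₒ-⟨⟩) ▸ ×₁-⟨⟩ identityˡ swapₒ-⟨⟩))
    ; symmetry   = λ _ _ → coherence (graph-⨟ γ γ) γ swapₒ∘swapₒ
    }

open Relations public using (Rel)

module _ {o ℓ e} (R : RegularCategory o ℓ e) where
  open SymmetricMonoidalPoCategory (Rel R) using (poCategory; unit; _⊗₀_; Hom)
  private
    module P = SymmetricMonoidalPoCategory (ℙoset (o ⊔ ℓ ⊔ e) (ℓ ⊔ e) (ℓ ⊔ e))

  Sub : PoFunctor poCategory P.poCategory
  Sub = Hom[unit,-] (Rel R)

  Sub-ρ : P.unit P.⇒ Hom unit unit
  Sub-ρ = Hom-ρ (Rel R)

  Sub-ρ₂ : ∀ r s → Hom unit r P.⊗₀ Hom unit s P.⇒ Hom unit (r ⊗₀ s)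
  Sub-ρ₂ = Hom-ρ₂ (Rel R)

{-# OPTIONS --safe #-}

-- The laxator φ ⊠ ψ is determined by its generalized elements: v : T → r × s belongs to it
-- iff π₁ ∘ v belongs to φ and π₂ ∘ v to ψ (relations from 1 carry a further component
-- T → 1, which holds no information). The laxity equations become rearrangements of
-- conjunctions. The left adjoint of ⊠ sends x to its images ∃₁ x and ∃₂ x along the
-- projections: x lies in the product of its images, and the projections of φ ⊠ ψ lie in φ
-- and ψ.
module Submission where

open import Defs
open Relations using (graph)
open import Level using (Level; _⊔_)
open import Data.Product using (_×_; _,_; proj₁; proj₂)
open import Data.Unit.Polymorphic using (tt)
open import Relation.Binary.Bundles using (Poset)
open import Data.Product.Relation.Binary.Pointwise.NonDependent using (×-poset)
open import Relation.Binary.Morphism.Bundles using (PosetHomomorphism; mkPosetHomo)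

open PosetHomomorphism using (⟦_⟧) renaming (mono to ⟦⟧-mono)

pairing : ∀ {c ℓ₁ ℓ₂} {P Q S : Poset c ℓ₁ ℓ₂} →
          PosetHomomorphism P Q → PosetHomomorphism P S → PosetHomomorphism P (×-poset Q S)
pairing {P = P} {Q} {S} f g = mkPosetHomo P (×-poset Q S)
  (λ x → ⟦ f ⟧ x , ⟦ g ⟧ x) (λ p → ⟦⟧-mono f p , ⟦⟧-mono g p)

-- The names taken from Relations R are copies that must be unfolded before they match the
-- originals; for graph, whose copy unfolds relation types completely, the original is used
-- (graph R f).
module SubobjectLaxator {o ℓ e : Level} (R : RegularCategory o ℓ e) where
  open RegularCategory R
  open RegularCategoryProperties R
  open Relations R hiding (Rel; graph)
  open PoCategory Rel-poCategory using () renaming (assoc to ⨟-assoc)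

  -- For an isomorphism `f` the middle element of the composite can only be `f⁻¹ ∘ c`, so it exists
  -- without passing to a cover. This reduces the laws for associator and swap to equivalences of
  -- memberships.
  ⨟graph-≅ : ∀ {r s t} (x : Relation r s) (y : Relation r t) {f : s ⇒ t} {f⁻¹ : t ⇒ s} →
             f⁻¹ ∘ f ≈ id → f ∘ f⁻¹ ≈ id →
             (∀ {T} {a : T ⇒ r} {c : T ⇒ t} → x ∋ ⟨ a , f⁻¹ ∘ c ⟩ → y ∋ ⟨ a , c ⟩) →
             (∀ {T} {a : T ⇒ r} {c : T ⇒ t} → y ∋ ⟨ a , c ⟩ → x ∋ ⟨ a , f⁻¹ ∘ c ⟩) →
             x ⨟ graph R f ≅ y
  ⨟graph-≅ x y {f} {f⁻¹} p q to from = ⊆-antisym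
    (⊆-intro {x = x ⨟ graph R f} {y} (λ {_} {a} {c} m →
      to {a = a} {c} (⨟graph-elim {f = f} {f⁻¹} p x {a} {c} m)))
    (⊆-intro {x = y} {x ⨟ graph R f} (λ {_} {a} {c} m →
      ⨟graph-intro {f = f} {f⁻¹} q x {a} {c} (from m)))

  module _ {r s t} (x : Relation r s) (f : s ⇒ t) where

    ⨟graph-∋ : ∀ {T} {a : T ⇒ r} {b : T ⇒ s} {c : T ⇒ t} →
               f ∘ b ≈ c → x ∋ ⟨ a , b ⟩ → x ⨟ graph R f ∋ ⟨ a , c ⟩
    ⨟graph-∋ {a = a} {b} {c} p m =
      ⨟-intro x (graph R f) {a} {b} {c} m (graph-intro {f = f} {b} {c} p)

    -- The composite is the image of `x` along `f`: after a cover `q`, `c ∘ q` has the form `f ∘ b`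
    -- with `b` in `x`.
    ⨟graph-⊆ : (y : Relation r t) →
               (∀ {T} {a : T ⇒ r} {b : T ⇒ s} → x ∋ ⟨ a , b ⟩ → y ∋ ⟨ a , f ∘ b ⟩) →
               x ⨟ graph R f ⊆ y
    ⨟graph-⊆ y h = ⊆-intro {x = x ⨟ graph R f} {y} (λ {_} {a} {c} →
      ⨟-elim₂ {x = x} {graph R f} y {a} {c} {a} {c} (λ q {b} m n →
        ∋-resp₂ y ≈-refl (graph-elim {f = f} {b} {c ∘ q} n) (h {a = a ∘ q} {b} m)))

  infixr 8 _⊠_
  -- This is the value of `Sub-ρ₂` at the pair: `graph R ⟨ ! , id ⟩` is `λ⇐` at the unit.
  _⊠_ : ∀ {r s} → Relation 𝟙 r → Relation 𝟙 s → Relation 𝟙 (r ×ₒ s)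
  φ ⊠ ψ = graph R ⟨ ! , id ⟩ ⨟ (φ ⊗ ψ)

  module _ {r s} (φ : Relation 𝟙 r) (ψ : Relation 𝟙 s) where

    ⊠-intro : ∀ {T} {t t′ t″ : T ⇒ 𝟙} {v : T ⇒ r ×ₒ s} →
              φ ∋ ⟨ t , π₁ ∘ v ⟩ → ψ ∋ ⟨ t′ , π₂ ∘ v ⟩ → φ ⊠ ψ ∋ ⟨ t″ , v ⟩
    ⊠-intro m n = graph⨟-intro ⟨ ! , id ⟩ (φ ⊗ ψ) (⊗-intro φ ψ
      (∋-resp₂ φ !-unique₂ ≈-refl m) (∋-resp₂ ψ !-unique₂ ≈-refl n))

    ⊠-elim : ∀ {T} {t : T ⇒ 𝟙} {v : T ⇒ r ×ₒ s} →
             φ ⊠ ψ ∋ ⟨ t , v ⟩ → φ ∋ ⟨ ! , π₁ ∘ v ⟩ × ψ ∋ ⟨ ! , π₂ ∘ v ⟩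
    ⊠-elim m =
      let m₁ , m₂ = ⊗-elim φ ψ (graph⨟-elim ⟨ ! , id ⟩ (φ ⊗ ψ) m)
      in ∋-resp₂ φ !-unique₂ ≈-refl m₁ , ∋-resp₂ ψ !-unique₂ ≈-refl m₂

  -- Since `⊠` is `⊗` precomposed with a fixed relation, the interchange law and reassociation
  -- suffice, without elements.
  ⊠-natural : ∀ {r s r′ s′} (φ : Relation 𝟙 r) (ψ : Relation 𝟙 s)
              (f : Relation r r′) (g : Relation s s′) →
              (φ ⨟ f) ⊠ (ψ ⨟ g) ≅ (φ ⊠ ψ) ⨟ (f ⊗ g)
  ⊠-natural φ ψ f g = Sub.Eq.trans
    (⨟-cong (Sub.Eq.refl {x = graph R ⟨ ! , id ⟩}) (⊗-⨟ φ f ψ g))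
    (Sub.Eq.sym (⨟-assoc {f = graph R ⟨ ! , id ⟩} {φ ⊗ ψ} {f ⊗ g}))

  -- Both sides ask that the three components of an element lie in `φ`, `ψ` and `χ`; `e₁` to `e₃`
  -- identify the components of `assoc⁻¹ ∘ c` with those of `c`.
  ⊠-assoc : ∀ {r s t} (φ : Relation 𝟙 r) (ψ : Relation 𝟙 s) (χ : Relation 𝟙 t) →
            ((φ ⊠ ψ) ⊠ χ) ⨟ graph R assocₒ ≅ φ ⊠ (ψ ⊠ χ)
  ⊠-assoc {r} {s} {t} φ ψ χ =
    ⨟graph-≅ ((φ ⊠ ψ) ⊠ χ) (φ ⊠ (ψ ⊠ χ))
      {f = assocₒ {r} {s} {t}} {f⁻¹ = assoc⁻¹} assocₒ⁻¹∘assocₒ assocₒ∘assocₒ⁻¹ to from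
    where
    assoc⁻¹ : r ×ₒ (s ×ₒ t) ⇒ (r ×ₒ s) ×ₒ t
    assoc⁻¹ = assocₒ⁻¹

    module _ {T} {a : T ⇒ 𝟙} {c : T ⇒ r ×ₒ (s ×ₒ t)} where
      e₁ : π₁ ∘ π₁ ∘ assoc⁻¹ ∘ c ≈ π₁ ∘ c
      e₁ = ≈-trans (∘-congˡ (pullˡ project₁)) (pullˡ project₁)
      e₂ : π₂ ∘ π₁ ∘ assoc⁻¹ ∘ c ≈ π₁ ∘ π₂ ∘ c
      e₂ = ≈-trans (∘-congˡ (pullˡ project₁)) (≈-trans (pullˡ project₂) assoc)
      e₃ : π₂ ∘ assoc⁻¹ ∘ c ≈ π₂ ∘ π₂ ∘ c
      e₃ = ≈-trans (pullˡ project₂) assoc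

      to : (φ ⊠ ψ) ⊠ χ ∋ ⟨ a , assoc⁻¹ ∘ c ⟩ → φ ⊠ (ψ ⊠ χ) ∋ ⟨ a , c ⟩
      to m =
        let m₁₂ , m₃ = ⊠-elim (φ ⊠ ψ) χ {t = a} {assoc⁻¹ ∘ c} m
            m₁ , m₂ = ⊠-elim φ ψ {t = ! } {π₁ ∘ assoc⁻¹ ∘ c} m₁₂
        in ⊠-intro φ (ψ ⊠ χ) {v = c} (∋-resp₂ φ ≈-refl e₁ m₁)
             (⊠-intro ψ χ {t″ = ! } {π₂ ∘ c}
               (∋-resp₂ ψ ≈-refl e₂ m₂) (∋-resp₂ χ ≈-refl e₃ m₃))

      from : φ ⊠ (ψ ⊠ χ) ∋ ⟨ a , c ⟩ → (φ ⊠ ψ) ⊠ χ ∋ ⟨ a , assoc⁻¹ ∘ c ⟩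
      from m =
        let m₁ , m₂₃ = ⊠-elim φ (ψ ⊠ χ) {t = a} {c} m
            m₂ , m₃ = ⊠-elim ψ χ {t = ! } {π₂ ∘ c} m₂₃
        in ⊠-intro (φ ⊠ ψ) χ {v = assoc⁻¹ ∘ c}
             (⊠-intro φ ψ {t″ = ! } {π₁ ∘ assoc⁻¹ ∘ c}
               (∋-resp₂ φ ≈-refl (≈-sym e₁) m₁) (∋-resp₂ ψ ≈-refl (≈-sym e₂) m₂))
             (∋-resp₂ χ ≈-refl (≈-sym e₃) m₃)

  ⊠-swap : ∀ {r s} (φ : Relation 𝟙 r) (ψ : Relation 𝟙 s) →
           (φ ⊠ ψ) ⨟ graph R swapₒ ≅ ψ ⊠ φ
  ⊠-swap {r} {s} φ ψ =
    ⨟graph-≅ (φ ⊠ ψ) (ψ ⊠ φ)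
      {f = swapₒ {r} {s}} {f⁻¹ = swap⁻¹} swapₒ∘swapₒ swapₒ∘swapₒ to from
    where
    swap⁻¹ : s ×ₒ r ⇒ r ×ₒ s
    swap⁻¹ = swapₒ

    module _ {T} {a : T ⇒ 𝟙} {c : T ⇒ s ×ₒ r} where
      to : φ ⊠ ψ ∋ ⟨ a , swap⁻¹ ∘ c ⟩ → ψ ⊠ φ ∋ ⟨ a , c ⟩
      to m =
        let m₁ , m₂ = ⊠-elim φ ψ {t = a} {swap⁻¹ ∘ c} m
        in ⊠-intro ψ φ {v = c} (∋-resp₂ ψ ≈-refl (pullˡ project₂) m₂)
                               (∋-resp₂ φ ≈-refl (pullˡ project₁) m₁)

      from : ψ ⊠ φ ∋ ⟨ a , c ⟩ → φ ⊠ ψ ∋ ⟨ a , swap⁻¹ ∘ c ⟩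
      from m =
        let m₂ , m₁ = ⊠-elim ψ φ {t = a} {c} m
        in ⊠-intro φ ψ {v = swap⁻¹ ∘ c} (∋-resp₂ φ ≈-refl (≈-sym (pullˡ project₁)) m₁)
                                        (∋-resp₂ ψ ≈-refl (≈-sym (pullˡ project₂)) m₂)

  -- Named so that they stay folded during conversion checking.
  ∃₁ : ∀ {r s} → Relation 𝟙 (r ×ₒ s) → Relation 𝟙 r
  ∃₁ x = x ⨟ graph R π₁

  ∃₂ : ∀ {r s} → Relation 𝟙 (r ×ₒ s) → Relation 𝟙 s
  ∃₂ x = x ⨟ graph R π₂

  ⊤ᵣ : Relation 𝟙 𝟙
  ⊤ᵣ = graph R id

  module _ {r s} (x : Relation 𝟙 (r ×ₒ s)) where

    ∃₁-∋ : ∀ {T} {t : T ⇒ 𝟙} {v : T ⇒ r ×ₒ s} {a : T ⇒ r} →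
           π₁ ∘ v ≈ a → x ∋ ⟨ t , v ⟩ → ∃₁ x ∋ ⟨ t , a ⟩
    ∃₁-∋ = ⨟graph-∋ x π₁

    ∃₂-∋ : ∀ {T} {t : T ⇒ 𝟙} {v : T ⇒ r ×ₒ s} {b : T ⇒ s} →
           π₂ ∘ v ≈ b → x ∋ ⟨ t , v ⟩ → ∃₂ x ∋ ⟨ t , b ⟩
    ∃₂-∋ = ⨟graph-∋ x π₂

  module _ {r s} (φ : Relation 𝟙 r) (ψ : Relation 𝟙 s) where

    -- Half of the counit. The inclusion can be strict, because an element of `φ ⊠ ψ` also requires
    -- one of `ψ`.
    ∃₁-⊠-⊆ : ∃₁ (φ ⊠ ψ) ⊆ φ
    ∃₁-⊠-⊆ = ⨟graph-⊆ (φ ⊠ ψ) π₁ φ (λ {_} {t} {v} m →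
      ∋-resp₂ φ !-unique₂ ≈-refl (proj₁ (⊠-elim φ ψ {t = t} {v} m)))

    ∃₂-⊠-⊆ : ∃₂ (φ ⊠ ψ) ⊆ ψ
    ∃₂-⊠-⊆ = ⨟graph-⊆ (φ ⊠ ψ) π₂ ψ (λ {_} {t} {v} m →
      ∋-resp₂ ψ !-unique₂ ≈-refl (proj₂ (⊠-elim φ ψ {t = t} {v} m)))

  -- The unit: an element `v` of `x` itself witnesses that its two projections lie in the images.
  ⊆-⊠-∃ : ∀ {r s} (x : Relation 𝟙 (r ×ₒ s)) → x ⊆ ∃₁ x ⊠ ∃₂ x
  ⊆-⊠-∃ x = ⊆-intro {x = x} {∃₁ x ⊠ ∃₂ x} (λ {_} {t} {v} m →
    ⊠-intro (∃₁ x) (∃₂ x) {v = v} (∃₁-∋ x {t = t} {v} ≈-refl m) (∃₂-∋ x {t = t} {v} ≈-refl m))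

  ∋-⊤ᵣ : ∀ {T} {t u : T ⇒ 𝟙} → ⊤ᵣ ∋ ⟨ t , u ⟩
  ∋-⊤ᵣ {t = t} {u} = graph-intro {f = id} {t} {u} !-unique₂

  ⊆-⊤ᵣ : (x : Relation 𝟙 𝟙) → x ⊆ ⊤ᵣ
  ⊆-⊤ᵣ x = ⊆-intro {x = x} {⊤ᵣ} (λ {_} {t} {u} _ → ∋-⊤ᵣ {t = t} {u})

  -- Left unitality, `π₂` being the unitor. The counit inclusion becomes an equality because every
  -- pair of maps to `𝟙` belongs to `⊤ᵣ`.
  ⊠-identityˡ : ∀ {r} (φ : Relation 𝟙 r) → ∃₂ (⊤ᵣ ⊠ φ) ≅ φ
  ⊠-identityˡ φ = ⊆-antisym (∃₂-⊠-⊆ ⊤ᵣ φ)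
    (⊆-intro {x = φ} {∃₂ (⊤ᵣ ⊠ φ)} (λ {_} {t} {a} m →
      -- The preimage of `a` under `π₂` needs some map to `𝟙` as first component; `t` is at hand.
      ∃₂-∋ (⊤ᵣ ⊠ φ) {t = t} {⟨ t , a ⟩} project₂
        (⊠-intro ⊤ᵣ φ {v = ⟨ t , a ⟩} (∋-⊤ᵣ {t = t})
          (∋-resp₂ φ ≈-refl (≈-sym project₂) m))))

  ⊠-identityʳ : ∀ {r} (φ : Relation 𝟙 r) → ∃₁ (φ ⊠ ⊤ᵣ) ≅ φ
  ⊠-identityʳ φ = ⊆-antisym (∃₁-⊠-⊆ φ ⊤ᵣ)
    (⊆-intro {x = φ} {∃₁ (φ ⊠ ⊤ᵣ)} (λ {_} {t} {a} m →
      ∃₁-∋ (φ ⊠ ⊤ᵣ) {t = t} {⟨ a , t ⟩} project₁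
        (⊠-intro φ ⊤ᵣ {v = ⟨ a , t ⟩}
          (∋-resp₂ φ ≈-refl (≈-sym project₁) m) (∋-⊤ᵣ {t = t}))))

  private
    module C = SymmetricMonoidalPoCategory (Rel R)
    module D = SymmetricMonoidalPoCategory (ℙoset (o ⊔ ℓ ⊔ e) (ℓ ⊔ e) (ℓ ⊔ e))
  open PoFunctor (Sub R) using (F₀; F₁)

  projections : ∀ r s → F₀ (r C.⊗₀ s) D.⇒ F₀ r D.⊗₀ F₀ s
  projections r s = pairing (F₁ (graph R π₁)) (F₁ (graph R π₂))

  -- The endpoints of an inequality are replaced through ≈: _≅_ is a record, so that its
  -- arguments are compared as they stand, whereas _⊆_ would unfold them into images.
  projections-unit : ∀ r s → D.id D.≤ (projections r s D.⨟ Sub-ρ₂ R r s)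
  projections-unit r s x = P.≤-respʳ-≈ {x} {∃₁ x ⊠ ∃₂ x}
    {⟦ projections r s D.⨟ Sub-ρ₂ R r s ⟧ x} (P.Eq.refl {∃₁ x ⊠ ∃₂ x}) (⊆-⊠-∃ x)
    where module P = Poset (F₀ (r C.⊗₀ s))

  projections-counit : ∀ r s → (Sub-ρ₂ R r s D.⨟ projections r s) D.≤ D.id
  projections-counit r s (φ , ψ) =
    P.≤-respˡ-≈ {φ} {∃₁ (φ ⊠ ψ)} {⟦ F₁ (graph R π₁) ⟧ (⟦ Sub-ρ₂ R r s ⟧ (φ , ψ))}
      (P.Eq.refl {∃₁ (φ ⊠ ψ)}) (∃₁-⊠-⊆ φ ψ) ,
    Q.≤-respˡ-≈ {ψ} {∃₂ (φ ⊠ ψ)} {⟦ F₁ (graph R π₂) ⟧ (⟦ Sub-ρ₂ R r s ⟧ (φ , ψ))}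
      (Q.Eq.refl {∃₂ (φ ⊠ ψ)}) (∃₂-⊠-⊆ φ ψ)
    where
    module P = Poset (F₀ r)
    module Q = Poset (F₀ s)

  isAjax : IsAjax {C = Rel R} {D = ℙoset (o ⊔ ℓ ⊔ e) (ℓ ⊔ e) (ℓ ⊔ e)}
                  (Sub R) (Sub-ρ R) (Sub-ρ₂ R)
  isAjax = record
    { isLaxSymmetricMonoidal = record
      { natural       = λ f g (φ , ψ) → ⊠-natural φ ψ f g
      ; associativity = λ _ _ _ ((φ , ψ) , χ) → ⊠-assoc φ ψ χ
      ; unitalityˡ    = λ _ (_ , φ) → ⊠-identityˡ φ
      ; unitalityʳ    = λ _ (φ , _) → ⊠-identityʳ φ
      ; symmetric     = λ _ _ (φ , ψ) → ⊠-swap φ ψ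
      }
    ; ρ-isRightAdjoint       =
        -- The left adjoint of `ρ` is the map to the one-point poset; its unit says that the
        -- identity relation on `𝟙` is the greatest one.
        mkPosetHomo (F₀ C.unit) D.unit (λ _ → tt) (λ _ → tt) , ⊆-⊤ᵣ , (λ _ → tt)
    ; ρ₂-isRightAdjoint      = λ r s →
        projections r s , projections-unit r s , projections-counit r s
    }

theorem19 : ∀ {o ℓ e : Level} (R : RegularCategory o ℓ e) →
    IsAjax {C = Rel R} {D = ℙoset (o ⊔ ℓ ⊔ e) (ℓ ⊔ e) (ℓ ⊔ e)} (Sub R) (Sub-ρ R) (Sub-ρ₂ R)
theorem19 = SubobjectLaxator.isAjax
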